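{- Let $K$ be a quadratic field and $c \in K$. Then the directed graph $G(f_c,K)$ does not contain a subgraph isomorphic to the graph $G_5$.
   Context: For $f_c(z) = z^2 + c$ and a number field $K$, $G(f_c,K)$ is the directed graph whose vertices are the points of $K$ (the point at infinity excluded) that are preperiodic for $f_c$, with an edge $x \to y$ iff $f_c(x) = y$. The graph $G_5$ has twelve vertices $p, q, \bar p, \bar q, a, a', b, b', s, \bar s, r, \bar r$ and edges $p \to q$, $q \to p$, $\bar p \to q$, $\bar q \to p$, $a \to a$, $b \to a$, $a' \to a'$, $b' \to a'$, $s \to b$, $\bar s \to b$, $r \to b'$, $\bar r \to b'$ (equivalently: a $2$-cycle, two distinct fixed points, and two points $s, r$ of preperiodic type $1_2$ with $f_c(s) \neq f_c(r)$, together with the preimages these force). -}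

module Defs where

open import Data.Nat as ℕ using (ℕ; zero; suc; _<_)
open import Data.Nat.Divisibility using (_∣_)
open import Data.Integer as ℤ using (ℤ; ∣_∣)
open import Data.Rational as ℚ using (ℚ; _/_)
open import Data.Product using (Σ; _×_; _,_; ∃₂)
open import Function.Definitions using (Injective)
open import Relation.Binary.PropositionalEquality using (_≡_)

-- Squarefree integer d: no square n*n with n ≠ 1 divides d.
-- (This excludes d = 0, since 0*0 ∣ 0.)
SquareFree : ℤ → Set
SquareFree d = ∀ (n : ℕ) → (n ℕ.* n) ∣ ∣ d ∣ → n ≡ 1

-- The quadratic field ℚ(√d) (d squarefree, d ≠ 1): the element a + b√d
-- is represented by the pair (a , b) of rationals.
QF : ℤ → Set
QF d = ℚ × ℚ

module _ (d : ℤ) where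
  dℚ : ℚ
  dℚ = d / 1

  _⊕_ : QF d → QF d → QF d
  (a , b) ⊕ (a' , b') = (a ℚ.+ a' , b ℚ.+ b')

  _⊗_ : QF d → QF d → QF d
  (a , b) ⊗ (a' , b') =
    (a ℚ.* a' ℚ.+ dℚ ℚ.* (b ℚ.* b') , a ℚ.* b' ℚ.+ b ℚ.* a')

  f : QF d → QF d → QF d
  f c z = (z ⊗ z) ⊕ c

  iter : ℕ → QF d → QF d → QF d
  iter zero    c z = z
  iter (suc n) c z = f c (iter n c z)

  Preperiodic : QF d → QF d → Set
  Preperiodic c x = ∃₂ λ m n → m < n × iter m c x ≡ iter n c x

data V5 : Set where
  p q p¯ q¯ a a' b b' s s¯ r r¯ : V5

-- G_5 is a functional graph: each vertex has exactly one outgoing edge,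
-- namely v → next v.
next : V5 → V5
next p  = q
next q  = p
next p¯ = q
next q¯ = p
next a  = a
next b  = a
next a' = a'
next b' = a'
next s  = b
next s¯ = b
next r  = b'
next r¯ = b'

-- G(f_c, K) contains a subgraph isomorphic to G_5: an injective map of the
-- vertices of G_5 to preperiodic points of K sending every edge u → v of G_5
-- to an edge φ u → φ v of G(f_c,K), i.e. f_c(φ u) = φ v.
record ContainsG5 (d : ℤ) (c : QF d) : Set where
  field
    φ       : V5 → QF d
    inj     : Injective _≡_ _≡_ φ
    preper  : ∀ v → Preperiodic d c (φ v)
    edges   : ∀ v → f d c (φ v) ≡ φ (next v)

{-# OPTIONS --safe #-}

-- Put x = a - a', u = 2s, v = 2r, w = p - q. The edges of G₅ give
--   u² = (x + 1)(x - 3),  v² = (x - 1)(x + 3),  w² = x² - 4,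
-- so (z , y) = (x , uv), (2x - 1 , 4uw), (2x + 1 , 4vw) are K-points on the curves
-- y² = (z² - A²)(z² - B²) with (A , B) = (1 , 3), (3 , 5), (3 , 5).
--
-- Rational points: y² + (B ∓ A)² z² = (z² ∓ AB)², and α² + δ² = □, α² + k²δ² = □ has only
-- trivial solutions for k = 2, 4 by infinite descent. Hence z ∈ {0, ±A, ±B}.
-- If x ∈ ℚ, two of u², v², w² agree modulo rational squares and x is found this way.
--
-- If x ∉ ℚ, let T and N be the trace and norm of z. Writing y = z² + αz + β with rational
-- α, β, the residual intersection of this parabola with the quartic is a rational point,
-- one of finitely many; so (T , N) lies on one of finitely many lines and conics. The three
-- curves together leave only values of (T , N) for which x is rational or one of u², v²
-- is not a square in K.
module Submission where

-- The three curves come from multiplying the squares u², v², w² in pairs. The shifts 2x - 1 and 2x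
-- + 1 centre the four roots of (x + 1)(x - 3)(x² - 4) and (x - 1)(x + 3)(x² - 4), so that both
-- quartics become even. The two values of k are (B + A) / (B - A) for the pairs (1 , 3) and (3 ,
-- 5). One curve alone cannot exclude irrational x: it has infinitely many quadratic points over
-- varying fields, and knowing the sum of a point and its conjugate gives a single equation in (T ,
-- N). With three curves the pair (T , N) is overdetermined. Working with T and N also removes the
-- field from the argument. What remains of ℚ(√D) is that T² - 4N is not a rational square, and that
-- the norm and trace of u and v are rational.

module Naturals where

  open import Data.Empty using (⊥; ⊥-elim)
  open import Data.Nat
  open import Data.Nat.Properties
  open import Data.Nat.Divisibility
  open import Data.Nat.DivMod
  open import Data.Nat.GCD
  open import Data.Nat.Coprimality as Co using (Coprime)
  open import Data.Nat.Primality using (prime[2]; euclidsLemma)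
  open import Data.Nat.Induction using (<-rec)
  open import Data.Nat.Tactic.RingSolver using (solve-∀)
  open import Data.Product using (∃; ∃₂; _×_; _,_; proj₁; proj₂)
  open import Data.Sum using (_⊎_; inj₁; inj₂; [_,_]′)
  open import Relation.Nullary
  open import Relation.Binary.PropositionalEquality

  -- Coprimality, parity and residues of natural numbers.

  IsSquare : ℕ → Set
  IsSquare n = ∃ λ m → m * m ≡ n

  coprime-∣ˡ : ∀ {m n o} → o ∣ m → Coprime m n → Coprime o n
  coprime-∣ˡ o∣m c (i∣o , i∣n) = c (∣-trans i∣o o∣m , i∣n)

  coprime-∣ʳ : ∀ {m n o} → o ∣ n → Coprime m n → Coprime m o
  coprime-∣ʳ o∣n c (i∣m , i∣o) = c (i∣m , ∣-trans i∣o o∣n)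

  abstract
    coprime-*ʳ : ∀ {m n o} → Coprime m n → Coprime m o → Coprime m (n * o)
    coprime-*ʳ m⊥n m⊥o (i∣m , i∣no) =
      m⊥o (i∣m , Co.coprime-divisor (coprime-∣ˡ i∣m m⊥n) i∣no)

  coprime-squares : ∀ {m n} → Coprime m n → Coprime (m * m) (n * n)
  coprime-squares c = coprime-*ʳ (Co.sym c²) (Co.sym c²)
    where c² = coprime-*ʳ (Co.sym c) (Co.sym c)

  odd⇒coprime2 : ∀ {n} → 2 ∤ n → Coprime n 2
  odd⇒coprime2 2∤n {zero} (_ , 0∣2) with () ← 0∣⇒≡0 0∣2
  odd⇒coprime2 2∤n {1} _ = refl
  odd⇒coprime2 2∤n {2} (2∣n , _) = ⊥-elim (2∤n 2∣n)
  odd⇒coprime2 2∤n {suc (suc (suc i))} (_ , i∣2) with s≤s (s≤s ()) ← ∣⇒≤ i∣2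

  abstract
    even² : ∀ n → 2 ∣ n * n → 2 ∣ n
    even² n 2∣n² = [ (λ x → x) , (λ x → x) ]′ (euclidsLemma n n prime[2] 2∣n²)

  even⊎odd : ∀ n → (∃ λ k → n ≡ 2 * k) ⊎ (∃ λ k → n ≡ 1 + 2 * k)
  even⊎odd zero = inj₁ (0 , refl)
  even⊎odd (suc n) with even⊎odd n
  ... | inj₁ (k , refl) = inj₂ (k , refl)
  ... | inj₂ (k , refl) = inj₁ (suc k , cong suc (sym (+-suc k (k + 0))))

  abstract
    odd-square : ∀ {n} → 2 ∤ n → ∃ λ j → n * n ≡ 1 + 8 * j
    odd-square {n} 2∤n with even⊎odd n
    ... | inj₁ (k , refl) = ⊥-elim (2∤n (m∣m*n k))
    ... | inj₂ (k , refl) with even⊎odd k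
    ... | inj₁ (l , refl) = l * (1 + 2 * l) , lemma l
      where lemma : ∀ l → (1 + 2 * (2 * l)) * (1 + 2 * (2 * l)) ≡ 1 + 8 * (l * (1 + 2 * l))
            lemma = solve-∀
    ... | inj₂ (l , refl) = (1 + l) * (1 + 2 * l) , lemma l
      where lemma : ∀ l → (1 + 2 * (1 + 2 * l)) * (1 + 2 * (1 + 2 * l)) ≡ 1 + 8 * ((1 + l) * (1 + 2 * l))
            lemma = solve-∀

  residue-≡ : ∀ n x y a b .{{_ : NonZero n}} → a + n * x ≡ b + n * y → a % n ≡ b % n
  residue-≡ n x y a b eq = begin
    a % n             ≡⟨ [m+kn]%n≡m%n a x n ⟨
    (a + x * n) % n   ≡⟨ cong (λ t → (a + t) % n) (*-comm x n) ⟩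
    (a + n * x) % n   ≡⟨ cong (_% n) eq ⟩
    (b + n * y) % n   ≡⟨ cong (λ t → (b + t) % n) (*-comm n y) ⟩
    (b + y * n) % n   ≡⟨ [m+kn]%n≡m%n b y n ⟩
    b % n             ∎
    where open ≡-Reasoning

  -- Factorisations through gcds and primitive Pythagorean triples.

  abstract
    -- Take `a` to be the gcd of `m` and `o`. The cofactors `b` and `c` are coprime and b n = c l,
    -- so `b` divides `l`.
    four-numbers : ∀ {m n o l} → m ≢ 0 → m * n ≡ o * l →
      ∃₂ λ a b → ∃₂ λ c d →
      m ≡ a * b × n ≡ c * d × o ≡ a * c × l ≡ b * d × Coprime b c
    four-numbers {m} {n} {o} {l} m≢0 mn≡ol with mkGCD m o
    ... | g , isGCD@(GCD.is (divides b m≡bg , divides c o≡cg) _) =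
      g , b , c , quotient b∣l , trans m≡bg (*-comm b g) ,
      *-cancelˡ-≡ n _ b (trans bn≡cl
        (trans (cong (c *_) (m∣n⇒n≡m*quotient b∣l)) (swap-left c b (quotient b∣l)))) ,
      trans o≡cg (*-comm c g) , m∣n⇒n≡m*quotient b∣l , b⊥c
      where
      instance
        b≢0 : NonZero b
        b≢0 = ≢-nonZero λ { refl → m≢0 m≡bg }
        g≢0 : NonZero g
        g≢0 = ≢-nonZero λ { refl → m≢0 (trans m≡bg (*-zeroʳ b)) }
      swap-left : ∀ x y z → x * (y * z) ≡ y * (x * z)
      swap-left = solve-∀
      rotate : ∀ x y z → x * (y * z) ≡ y * x * z
      rotate = solve-∀
      b⊥c : Coprime b c
      b⊥c = Co.GCD≡1⇒coprime (GCD-* {c = g}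
        (subst₂ (λ x y → GCD x y (1 * g)) m≡bg o≡cg
          (subst (GCD m o) (sym (*-identityˡ g)) isGCD)))
      bn≡cl : b * n ≡ c * l
      bn≡cl = *-cancelˡ-≡ (b * n) (c * l) g (begin
        g * (b * n) ≡⟨ rotate g b n ⟩
        b * g * n   ≡⟨ cong (_* n) m≡bg ⟨
        m * n       ≡⟨ mn≡ol ⟩
        o * l       ≡⟨ cong (_* l) o≡cg ⟩
        c * g * l   ≡⟨ rotate g c l ⟨
        g * (c * l) ∎)
        where open ≡-Reasoning
      b∣l : b ∣ l
      b∣l = Co.coprime-divisor b⊥c (divides n (trans (sym bn≡cl) (*-comm b n)))

  abstract
    -- Split m n = g g into four numbers, so that a c = b d. Since `a` is coprime to `d` it divides
    -- `b`, and since `b` is coprime to `c` it divides `a`; hence a = b and c = d.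
    coprime-factors-of-square : ∀ {m n g} → m ≢ 0 → Coprime m n → m * n ≡ g * g →
      ∃₂ λ x y → m ≡ x * x × n ≡ y * y × g ≡ x * y
    coprime-factors-of-square {m} {n} {g} m≢0 m⊥n mn≡g² =
      let (a , b , c , d , m≡ab , n≡cd , g≡ac , g≡bd , b⊥c) = four-numbers m≢0 mn≡g²
          ac≡bd = trans (sym g≡ac) g≡bd
          a≡b = same a b c d (subst₂ Coprime m≡ab n≡cd m⊥n) b⊥c ac≡bd
          m≡a² = trans m≡ab (cong (a *_) (sym a≡b))
          c≡d = cancel a c d (λ a≡0 → m≢0 (trans m≡a² (cong (_* a) a≡0)))
                  (trans ac≡bd (cong (_* d) (sym a≡b)))
      in a , c , m≡a² , trans n≡cd (cong (c *_) (sym c≡d)) , g≡ac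
      where
      same : ∀ a b c d → Coprime (a * b) (c * d) → Coprime b c → a * c ≡ b * d → a ≡ b
      same a b c d ab⊥cd b⊥c ac≡bd = ∣-antisym
        (Co.coprime-divisor (coprime-∣ˡ (m∣m*n b) (coprime-∣ʳ (n∣m*n c) ab⊥cd))
          (divides c (trans (*-comm d b) (trans (sym ac≡bd) (*-comm a c)))))
        (Co.coprime-divisor b⊥c (divides d (trans (*-comm c a) (trans ac≡bd (*-comm b d)))))
      cancel : ∀ a c d → a ≢ 0 → a * c ≡ a * d → c ≡ d
      cancel a c d a≢0 = *-cancelˡ-≡ c d a {{≢-nonZero a≢0}}

  -- With hypotenuse a + 2h the equation reads (a + h) h = g². The two factors are coprime, so both
  -- are squares.
  primitive-triple′ : ∀ a g h → 2 ∤ a → Coprime a g →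
    (a + 2 * h) * (a + 2 * h) ≡ a * a + (2 * g) * (2 * g) →
    ∃₂ λ m n → a + n * n ≡ m * m × m * n ≡ g × Coprime m n
  primitive-triple′ a g h 2∤a a⊥g eq =
    let (m , n , a+h≡m² , h≡n² , g≡mn) = coprime-factors-of-square a+h≢0 a+h⊥h product
        a+n²≡m² = trans (cong (a +_) (sym h≡n²)) a+h≡m²
    in m , n , a+n²≡m² , sym g≡mn , m⊥n m n a+n²≡m² g≡mn
    where
    expand : ∀ a h → (a + 2 * h) * (a + 2 * h) ≡ a * a + 4 * ((a + h) * h)
    expand = solve-∀
    collect : ∀ g → (2 * g) * (2 * g) ≡ 4 * (g * g)
    collect = solve-∀
    product : (a + h) * h ≡ g * g
    product = *-cancelˡ-≡ _ _ 4 (+-cancelˡ-≡ (a * a) _ _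
      (trans (sym (expand a h)) (trans eq (cong (a * a +_) (collect g)))))
    a+h≢0 : a + h ≢ 0
    a+h≢0 a+h≡0 = 2∤a (subst (2 ∣_) (sym (m+n≡0⇒m≡0 a a+h≡0)) (2 ∣0))
    a+h⊥h : Coprime (a + h) h
    a+h⊥h {i} (i∣a+h , i∣h) = coprime-*ʳ a⊥g a⊥g
      ( ∣m+n∣m⇒∣n (subst (i ∣_) (+-comm a h) i∣a+h) i∣h
      , subst (i ∣_) product (∣n⇒∣m*n (a + h) i∣h))
    m⊥n : ∀ m n → a + n * n ≡ m * m → g ≡ m * n → Coprime m n
    m⊥n m n a+n²≡m² g≡mn {i} (i∣m , i∣n) = a⊥g
      ( ∣m+n∣m⇒∣n
          (subst (i ∣_) (trans (sym a+n²≡m²) (+-comm a (n * n))) (∣m⇒∣m*n m i∣m))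
          (∣m⇒∣m*n n i∣n)
      , subst (i ∣_) (sym g≡mn) (∣m⇒∣m*n n i∣m))

  abstract
    -- The classical a = m² - n², g = m n, stated without truncated subtraction. The hypotenuse is a
    -- + e with `e` even, because e² = 4g² - 2ae.
    primitive-triple : ∀ {a g} → 2 ∤ a → Coprime a g →
      IsSquare (a * a + (2 * g) * (2 * g)) →
      ∃₂ λ m n → a + n * n ≡ m * m × m * n ≡ g × Coprime m n
    primitive-triple {a} {g} 2∤a a⊥g (c , c²≡) =
      let h = quotient (even² e 2∣e²)
          c≡ = trans (sym a+e≡c) (cong (a +_) (m∣n⇒n≡m*quotient (even² e 2∣e²)))
      in primitive-triple′ a g h 2∤a a⊥g (subst (λ c → c * c ≡ _) c≡ c²≡)
      where
      a≤c : a ≤ c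
      a≤c = ≮⇒≥ λ c<a → <⇒≱ (*-mono-< c<a c<a)
        (subst (a * a ≤_) (sym c²≡) (m≤m+n (a * a) _))
      e : ℕ
      e = c ∸ a
      a+e≡c : a + e ≡ c
      a+e≡c = m+[n∸m]≡n a≤c
      expand : ∀ a e → (a + e) * (a + e) ≡ a * a + (2 * (a * e) + e * e)
      expand = solve-∀
      collect : ∀ g → (2 * g) * (2 * g) ≡ 2 * g * g * 2
      collect = solve-∀
      2∣e² : 2 ∣ e * e
      2∣e² = ∣m+n∣m⇒∣n (divides (2 * g * g) (+-cancelˡ-≡ (a * a) _ _
        (trans (sym (expand a e)) (trans (cong (λ c → c * c) a+e≡c)
          (trans c²≡ (cong (a * a +_) (collect g))))))) (m∣m*n (a * e))

  -- Infinite descent for x² + y² and x² + k²y² both squares, k = 2 or 4.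

  even-square-residue : ∀ h n → (2 * h) * (2 * h) ≢ 2 + 4 * n
  even-square-residue h n eq = contradiction
    (residue-≡ 4 (h * h) n 0 2 (trans (quadruple h) eq)) λ ()
    where
    quadruple : ∀ h → 4 * (h * h) ≡ (2 * h) * (2 * h)
    quadruple = solve-∀

  odd+odd-nonsquare : ∀ {m n} → 2 ∤ m → 2 ∤ n → ¬ IsSquare (m * m + n * n)
  odd+odd-nonsquare {m} {n} 2∤m 2∤n (l , l²≡) =
    even-square-residue (quotient 2∣l) (2 * (i + j))
      (subst (λ l → l * l ≡ 2 + 4 * (2 * (i + j))) (m∣n⇒n≡m*quotient 2∣l) l²≡2+4k)
    where
    i j : ℕ
    i = odd-square 2∤m .proj₁
    j = odd-square 2∤n .proj₁
    add : ∀ i j → (1 + 8 * i) + (1 + 8 * j) ≡ 2 + 4 * (2 * (i + j))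
    add = solve-∀
    double : ∀ k → 2 + 4 * k ≡ (1 + 2 * k) * 2
    double = solve-∀
    l²≡2+4k : l * l ≡ 2 + 4 * (2 * (i + j))
    l²≡2+4k = trans l²≡ (trans (cong₂ _+_ (odd-square 2∤m .proj₂) (odd-square 2∤n .proj₂)) (add i j))
    2∣l : 2 ∣ l
    2∣l = even² l (divides (1 + 2 * (2 * (i + j))) (trans l²≡2+4k (double (2 * (i + j)))))

  -- A common factor e with x² + k²y² = ec² and x² + y² = eb² divides
  -- k² - 1 and is 1 modulo 2k.
  common-factor-trivial : ∀ {k e} → k ≡ 2 ⊎ k ≡ 4 → ∀ {c x y} → 2 ∤ x → 2 ∤ c →
    x * x + (k * y) * (k * y) ≡ e * (c * c) → (∀ m → k * k ≡ 1 + m → e ∣ m) → e ≡ 1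
  common-factor-trivial {e = e} (inj₁ refl) {c} {x} {y} 2∤x 2∤c eq e∣
    with odd-square 2∤x | odd-square 2∤c
  ... | i , x²≡ | l , c²≡ =
    from-yes (allUpTo? (λ n → (n % 4 ≟ 1) →-dec (n ∣? 3) →-dec (n ≟ 1)) 4)
      (s≤s (∣⇒≤ e∣3)) (residue-≡ 4 (2 * (e * l)) (2 * i + y * y) e 1
        (trans (left e l) (trans (cong (e *_) (sym c²≡)) (trans (sym eq)
          (trans (cong (_+ (2 * y) * (2 * y)) x²≡) (right i y)))))) e∣3
    where
    e∣3 = e∣ 3 refl
    left : ∀ e l → e + 4 * (2 * (e * l)) ≡ e * (1 + 8 * l)
    left = solve-∀
    right : ∀ i y → 1 + 8 * i + (2 * y) * (2 * y) ≡ 1 + 4 * (2 * i + y * y)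
    right = solve-∀
  common-factor-trivial {e = e} (inj₂ refl) {c} {x} {y} 2∤x 2∤c eq e∣
    with odd-square 2∤x | odd-square 2∤c
  ... | i , x²≡ | l , c²≡ =
    from-yes (allUpTo? (λ n → (n % 8 ≟ 1) →-dec (n ∣? 15) →-dec (n ≟ 1)) 16)
      (s≤s (∣⇒≤ e∣15)) (residue-≡ 8 (e * l) (i + 2 * (y * y)) e 1
        (trans (left e l) (trans (cong (e *_) (sym c²≡)) (trans (sym eq)
          (trans (cong (_+ (4 * y) * (4 * y)) x²≡) (right i y)))))) e∣15
    where
    e∣15 = e∣ 15 refl
    left : ∀ e l → e + 8 * (e * l) ≡ e * (1 + 8 * l)
    left = solve-∀
    right : ∀ i y → 1 + 8 * i + (4 * y) * (4 * y) ≡ 1 + 8 * (i + 2 * (y * y))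
    right = solve-∀

  abstract
    -- As b² and c² are coprime, x² + k²y² = ec² and x² + y² = eb² with the same `e`. Combining the
    -- two, `e` divides (k² - 1)x² and (k² - 1)y², hence k² - 1, and the residue of `e` leaves only
    -- e = 1.
    squares-from-proportion : ∀ {k} → k ≡ 2 ⊎ k ≡ 4 → ∀ {b c x y} →
      Coprime b c → Coprime x y → 2 ∤ x → 2 ∤ c →
      b * b * (x * x + (k * y) * (k * y)) ≡ c * c * (x * x + y * y) →
      IsSquare (x * x + y * y) × IsSquare (x * x + (k * y) * (k * y))
    squares-from-proportion {k} k∈ {b} {c} {x} {y} b⊥c x⊥y 2∤x 2∤c eq =
      (b , sym G≡b²) , (c , sym F≡c²)
      where
      F : ℕ
      F = x * x + (k * y) * (k * y)
      G : ℕ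
      G = x * x + y * y
      instance
        c²≢0 : NonZero (c * c)
        c²≢0 = ≢-nonZero λ c²≡0 → 2∤c (even² c (subst (2 ∣_) (sym c²≡0) (2 ∣0)))
      c²∣F : c * c ∣ F
      c²∣F = Co.coprime-divisor (coprime-squares (Co.sym b⊥c))
        (divides G (trans eq (*-comm (c * c) G)))
      e : ℕ
      e = quotient c²∣F
      F≡ : F ≡ e * (c * c)
      F≡ = m∣n⇒n≡quotient*m c²∣F
      swap : ∀ b c e → b * (e * c) ≡ c * (e * b)
      swap = solve-∀
      G≡ : G ≡ e * (b * b)
      G≡ = *-cancelˡ-≡ _ _ (c * c)
        (trans (sym eq) (trans (cong (b * b *_) F≡) (swap (b * b) (c * c) e)))
      e∣F : e ∣ F
      e∣F = divides (c * c) (trans F≡ (*-comm e (c * c)))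
      e∣G : e ∣ G
      e∣G = divides (b * b) (trans G≡ (*-comm e (b * b)))
      split-x : ∀ x y k m → k * k ≡ 1 + m →
        k * k * (x * x + y * y) ≡ x * x + (k * y) * (k * y) + x * x * m
      split-x x y k m k²≡ = trans (expand x y k) (trans
        (cong (λ t → t * (x * x) + (k * y) * (k * y)) k²≡) (regroup x y k m))
        where
        expand : ∀ x y k → k * k * (x * x + y * y) ≡ k * k * (x * x) + (k * y) * (k * y)
        expand = solve-∀
        regroup : ∀ x y k m → (1 + m) * (x * x) + (k * y) * (k * y) ≡
          x * x + (k * y) * (k * y) + x * x * m
        regroup = solve-∀
      split-y : ∀ x y k m → k * k ≡ 1 + m →
        x * x + (k * y) * (k * y) ≡ x * x + y * y + y * y * m
      split-y x y k m k²≡ = trans (expand x y k) (trans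
        (cong (λ t → x * x + t * (y * y)) k²≡) (regroup x y m))
        where
        expand : ∀ x y k → x * x + (k * y) * (k * y) ≡ x * x + k * k * (y * y)
        expand = solve-∀
        regroup : ∀ x y m → x * x + (1 + m) * (y * y) ≡ x * x + y * y + y * y * m
        regroup = solve-∀
      e∣ : ∀ m → k * k ≡ 1 + m → e ∣ m
      e∣ m k²≡ = Co.coprime-factors (coprime-squares x⊥y)
        ( ∣m+n∣m⇒∣n (subst (e ∣_) (split-x x y k m k²≡) (∣n⇒∣m*n (k * k) e∣G)) e∣F
        , ∣m+n∣m⇒∣n (subst (e ∣_) (split-y x y k m k²≡) e∣F) e∣G)
      e≡1 : e ≡ 1
      e≡1 = common-factor-trivial {k} {e} k∈ {c} {x} {y} 2∤x 2∤c F≡ e∣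
      F≡c² : F ≡ c * c
      F≡c² = trans F≡ (trans (cong (_* (c * c)) e≡1) (*-identityˡ (c * c)))
      G≡b² : G ≡ b * b
      G≡b² = trans G≡ (trans (cong (_* (b * b)) e≡1) (*-identityˡ (b * b)))

  odd⇒coprime-k : ∀ {k n} → k ≡ 2 ⊎ k ≡ 4 → 2 ∤ n → Coprime k n
  odd⇒coprime-k (inj₁ refl) 2∤n = Co.sym (odd⇒coprime2 2∤n)
  odd⇒coprime-k (inj₂ refl) 2∤n =
    Co.sym (coprime-*ʳ (odd⇒coprime2 2∤n) (odd⇒coprime2 2∤n))

  -- A predicate of `y` because the descent is on `y`; `x` is kept odd throughout.
  NoSquares : ℕ → ℕ → Set
  NoSquares k y = ∀ x → y ≢ 0 → 2 ∤ x → Coprime x y →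
    IsSquare (x * x + y * y) → ¬ IsSquare (x * x + (k * y) * (k * y))

  module _ {k} (k∈ : k ≡ 2 ⊎ k ≡ 4) {g} (g≢0 : g ≢ 0)
    (smaller : ∀ {y} → y < g * 2 → NoSquares k y) where

    private
      instance
        k≢0 : NonZero k
        k≢0 = [ (λ { refl → _ }) , (λ { refl → _ }) ]′ k∈

      ∣g⇒≢0 : ∀ {y} → y ∣ g → y ≢ 0
      ∣g⇒≢0 y∣g refl = g≢0 (0∣⇒≡0 y∣g)

      ∣g⇒<g*2 : ∀ {y} → y ∣ g → y < g * 2
      ∣g⇒<g*2 {y} y∣g = ≤-<-trans (∣⇒≤ {{≢-nonZero g≢0}} y∣g)
        (m<m*n g 2 {{≢-nonZero g≢0}} (s≤s (s≤s z≤n)))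

    -- With m = ab, n = cd, s = ac, t = bd the equation becomes b²(d² + a²) = c²(d² + k²a²). So (d ,
    -- a) is a new solution, and `a` divides g, which is half of the old `y`.
    descent-even-s : ∀ {m n s t} → m * n ≡ g → Coprime m n → 2 ∤ t → s * t ≡ g →
      m * m + t * t ≡ (k * s) * (k * s) + n * n → ⊥
    descent-even-s {m} {n} {s} {t} mn≡g m⊥n 2∤t st≡g eq =
      let (a , b , c , d , m≡ab , n≡cd , s≡ac , t≡bd , b⊥c) =
            four-numbers (∣g⇒≢0 (divides n (trans (sym mn≡g) (*-comm m n)))) (trans mn≡g (sym st≡g))
          a∣g = ∣-trans (m∣m*n b) (subst (_∣ g) m≡ab (divides n (trans (sym mn≡g) (*-comm m n))))
          a⊥d = coprime-∣ˡ (m∣m*n b) (coprime-∣ʳ (n∣m*n c) (subst₂ Coprime m≡ab n≡cd m⊥n))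
          2∤b = λ 2∣b → 2∤t (subst (2 ∣_) (sym t≡bd) (∣m⇒∣m*n d 2∣b))
          2∤d = λ 2∣d → 2∤t (subst (2 ∣_) (sym t≡bd) (∣n⇒∣m*n b 2∣d))
          (sq₁ , sq₂) = squares-from-proportion k∈ (Co.sym b⊥c) (Co.sym a⊥d) 2∤d 2∤b
            (proportion a b c d m≡ab n≡cd s≡ac t≡bd)
      in smaller (∣g⇒<g*2 a∣g) d (∣g⇒≢0 a∣g) 2∤d (Co.sym a⊥d) sq₁ sq₂
      where
      left : ∀ a c d k →
        c * c * (d * d + (k * a) * (k * a)) ≡ (k * (a * c)) * (k * (a * c)) + (c * d) * (c * d)
      left = solve-∀
      right : ∀ a b d → (a * b) * (a * b) + (b * d) * (b * d) ≡ b * b * (d * d + a * a)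
      right = solve-∀
      proportion : ∀ a b c d → m ≡ a * b → n ≡ c * d → s ≡ a * c → t ≡ b * d →
        c * c * (d * d + (k * a) * (k * a)) ≡ b * b * (d * d + a * a)
      proportion a b c d refl refl refl refl = trans (left a c d k) (trans (sym eq) (right a b d))

    -- The same splitting gives b²(a² + k²d²) = c²(a² + d²), so here the new solution is (a , d).
    descent-even-t : ∀ {m n s t} → m * n ≡ g → Coprime m n → 2 ∤ s → s * t ≡ g →
      m * m + (k * t) * (k * t) ≡ s * s + n * n → ⊥
    descent-even-t {m} {n} {s} {t} mn≡g m⊥n 2∤s st≡g eq =
      let (a , b , c , d , m≡ab , n≡cd , s≡ac , t≡bd , b⊥c) =
            four-numbers (∣g⇒≢0 (divides n (trans (sym mn≡g) (*-comm m n)))) (trans mn≡g (sym st≡g))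
          d∣g = ∣-trans (n∣m*n c) (subst (_∣ g) n≡cd (divides m (sym mn≡g)))
          a⊥d = coprime-∣ˡ (m∣m*n b) (coprime-∣ʳ (n∣m*n c) (subst₂ Coprime m≡ab n≡cd m⊥n))
          2∤a = λ 2∣a → 2∤s (subst (2 ∣_) (sym s≡ac) (∣m⇒∣m*n c 2∣a))
          2∤c = λ 2∣c → 2∤s (subst (2 ∣_) (sym s≡ac) (∣n⇒∣m*n a 2∣c))
          (sq₁ , sq₂) = squares-from-proportion k∈ b⊥c a⊥d 2∤a 2∤c
            (proportion a b c d m≡ab n≡cd s≡ac t≡bd)
      in smaller (∣g⇒<g*2 d∣g) a (∣g⇒≢0 d∣g) 2∤a a⊥d sq₁ sq₂
      where
      left : ∀ a b d k →
        b * b * (a * a + (k * d) * (k * d)) ≡ (a * b) * (a * b) + (k * (b * d)) * (k * (b * d))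
      left = solve-∀
      right : ∀ a c d → (a * c) * (a * c) + (c * d) * (c * d) ≡ c * c * (a * a + d * d)
      right = solve-∀
      proportion : ∀ a b c d → m ≡ a * b → n ≡ c * d → s ≡ a * c → t ≡ b * d →
        b * b * (a * a + (k * d) * (k * d)) ≡ c * c * (a * a + d * d)
      proportion a b c d refl refl refl refl = trans (left a b d k) (trans eq (right a c d))

    -- The odd number x is both m² - n² and s² - t². Thus `s` and `t` have opposite parity, and
    -- since st = kg with `k` a power of two, `k` divides the even one.
    descent-step : ∀ {x m n s t} → 2 ∤ x → m * n ≡ g → Coprime m n → s * t ≡ k * g →
      x + n * n ≡ m * m → x + t * t ≡ s * s → ⊥
    descent-step {x} {m} {n} {s} {t} 2∤x mn≡g m⊥n st≡kg x+n²≡m² x+t²≡s² = by-parity (2 ∣? t)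
      where
      exchange : ∀ x n t → x + n * n + t * t ≡ x + t * t + n * n
      exchange = solve-∀
      eq : m * m + t * t ≡ s * s + n * n
      eq = trans (cong (_+ t * t) (sym x+n²≡m²))
        (trans (exchange x n t) (cong (_+ n * n) x+t²≡s²))
      by-parity : Dec (2 ∣ t) → ⊥
      by-parity (no 2∤t) = descent-even-s mn≡g m⊥n 2∤t
        (*-cancelˡ-≡ (s′ * t) g k (trans (sym (*-assoc k s′ t)) (trans (cong (_* t) (sym s≡ks′)) st≡kg)))
        (subst (λ s → m * m + t * t ≡ s * s + n * n) s≡ks′ eq)
        where
        k∣s : k ∣ s
        k∣s = Co.coprime-divisor (odd⇒coprime-k k∈ 2∤t)
          (divides g (trans (*-comm t s) (trans st≡kg (*-comm k g))))
        s′ = quotient k∣s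
        s≡ks′ : s ≡ k * s′
        s≡ks′ = m∣n⇒n≡m*quotient k∣s
      by-parity (yes 2∣t) = descent-even-t mn≡g m⊥n 2∤s
        (*-cancelˡ-≡ (s * t′) g k (trans (rotate k s t′) (trans (cong (s *_) (sym t≡kt′)) st≡kg)))
        (subst (λ t → m * m + t * t ≡ s * s + n * n) t≡kt′ eq)
        where
        2∤s : 2 ∤ s
        2∤s 2∣s = 2∤x (∣m+n∣m⇒∣n
          (subst (2 ∣_) (trans (sym x+t²≡s²) (+-comm x (t * t))) (∣m⇒∣m*n s 2∣s)) (∣m⇒∣m*n t 2∣t))
        k∣t : k ∣ t
        k∣t = Co.coprime-divisor (odd⇒coprime-k k∈ 2∤s) (divides g (trans st≡kg (*-comm k g)))
        t′ = quotient k∣t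
        t≡kt′ : t ≡ k * t′
        t≡kt′ = m∣n⇒n≡m*quotient k∣t
        rotate : ∀ k s t → k * (s * t) ≡ s * (k * t)
        rotate = solve-∀

  no-squares-odd : ∀ {k} → k ≡ 2 ⊎ k ≡ 4 → ∀ y → NoSquares k y
  no-squares-odd {k} k∈ = <-rec (NoSquares k) step
    where
    rotate : ∀ k g → k * (g * 2) ≡ 2 * (k * g)
    rotate = solve-∀
    step : ∀ y → (∀ {z} → z < y → NoSquares k z) → NoSquares k y
    step y smaller x y≢0 2∤x x⊥y sq₁ sq₂ = by-parity (2 ∣? y)
      where
      by-parity : Dec (2 ∣ y) → ⊥
      by-parity (no 2∤y) = odd+odd-nonsquare 2∤x 2∤y sq₁
      by-parity (yes (divides g refl)) =
        let x⊥g = coprime-∣ʳ (m∣m*n 2) x⊥y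
            (m , n , x+n²≡m² , mn≡g , m⊥n) = primitive-triple 2∤x x⊥g
              (subst (λ t → IsSquare (x * x + t * t)) (*-comm g 2) sq₁)
            (s , t , x+t²≡s² , st≡kg , _) = primitive-triple 2∤x
              (coprime-*ʳ (Co.sym (odd⇒coprime-k k∈ 2∤x)) x⊥g)
              (subst (λ t → IsSquare (x * x + t * t)) (rotate k g) sq₂)
        in descent-step k∈ (λ { refl → y≢0 refl }) smaller {x} {m} {n} {s} {t} 2∤x mn≡g m⊥n st≡kg x+n²≡m² x+t²≡s²

  square-4* : ∀ n → IsSquare (4 * n) → IsSquare n
  square-4* n (l , l²≡4n) with even² l (subst (2 ∣_) (sym l²≡4n) (∣m⇒∣m*n n (divides 2 refl)))
  ... | divides h refl = h , *-cancelˡ-≡ (h * h) n 4 (trans (quadruple h) l²≡4n)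
    where
    quadruple : ∀ h → 4 * (h * h) ≡ (h * 2) * (h * 2)
    quadruple = solve-∀

  -- The sum is 5 modulo 8, while odd squares are 1. For k = 4 this rules out an `x` that is twice
  -- an odd number.
  odd+4*odd-nonsquare : ∀ {m n} → 2 ∤ m → 2 ∤ n → ¬ IsSquare (m * m + (2 * n) * (2 * n))
  odd+4*odd-nonsquare {m} {n} 2∤m 2∤n (l , l²≡) =
    contradiction (residue-≡ 8 h (i + 4 * j) 1 5 (trans (sym l²≡1+8h) l²≡5+8k)) λ ()
    where
    i j : ℕ
    i = odd-square 2∤m .proj₁
    j = odd-square 2∤n .proj₁
    regroup : ∀ i j → 1 + 8 * i + 4 * (1 + 8 * j) ≡ 5 + 8 * (i + 4 * j)
    regroup = solve-∀
    quadruple : ∀ n → (2 * n) * (2 * n) ≡ 4 * (n * n)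
    quadruple = solve-∀
    l²≡5+8k : l * l ≡ 5 + 8 * (i + 4 * j)
    l²≡5+8k = trans l²≡ (trans (cong₂ _+_ (odd-square 2∤m .proj₂)
      (trans (quadruple n) (cong (4 *_) (odd-square 2∤n .proj₂)))) (regroup i j))
    2∤l : 2 ∤ l
    2∤l 2∣l = 2∤m (even² m (∣m+n∣m⇒∣n
      (subst (2 ∣_) (trans l²≡ (+-comm (m * m) _)) (∣m⇒∣m*n l 2∣l))
      (∣m⇒∣m*n (2 * n) (m∣m*n n))))
    h : ℕ
    h = odd-square 2∤l .proj₁
    l²≡1+8h : l * l ≡ 1 + 8 * h
    l²≡1+8h = odd-square 2∤l .proj₂

  -- For even x one has k ∣ x, and (y , x / k) is a solution with odd first entry.
  no-squares : ∀ {k} → k ≡ 2 ⊎ k ≡ 4 → ∀ {x y} → x ≢ 0 → y ≢ 0 → Coprime x y →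
    IsSquare (x * x + y * y) → ¬ IsSquare (x * x + (k * y) * (k * y))
  no-squares {k} k∈ {x} {y} x≢0 y≢0 x⊥y sq₁ sq₂ = by-parity (2 ∣? x)
    where
    swapped : ∀ k → k ≡ 2 ⊎ k ≡ 4 → ∀ z → x ≡ k * z → 2 ∤ y → ¬ IsSquare (y * y + z * z)
    swapped k k∈ z x≡kz 2∤y sq = no-squares-odd k∈ z y
      (λ { refl → x≢0 (trans x≡kz (*-zeroʳ k)) }) 2∤y
      (Co.sym (coprime-∣ˡ (divides k x≡kz) x⊥y)) sq
      (subst IsSquare (trans (+-comm (x * x) (y * y)) (cong (λ t → y * y + t * t) x≡kz)) sq₁)
    double : ∀ y z → (2 * z) * (2 * z) + (2 * y) * (2 * y) ≡ 4 * (y * y + z * z)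
    double = solve-∀
    quadruple : ∀ y z → (2 * z) * (2 * z) + (4 * y) * (4 * y) ≡ 4 * (z * z + (2 * y) * (2 * y))
    quadruple = solve-∀
    by-parity : Dec (2 ∣ x) → ⊥
    by-parity (no 2∤x) = no-squares-odd k∈ y x y≢0 2∤x x⊥y sq₁ sq₂
    by-parity (yes 2∣x) = by-k k∈ sq₂
      where
      2∤y : 2 ∤ y
      2∤y 2∣y with () ← x⊥y (2∣x , 2∣y)
      z = quotient 2∣x
      x≡2z : x ≡ 2 * z
      x≡2z = m∣n⇒n≡m*quotient 2∣x
      by-k : ∀ {k} → k ≡ 2 ⊎ k ≡ 4 → ¬ IsSquare (x * x + (k * y) * (k * y))
      by-k (inj₁ refl) sq = swapped 2 (inj₁ refl) z x≡2z 2∤y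
        (square-4* _ (subst IsSquare
          (trans (cong (λ t → t * t + (2 * y) * (2 * y)) x≡2z) (double y z)) sq))
      by-k (inj₂ refl) sq = by-parity-z (2 ∣? z)
        where
        sq′ : IsSquare (z * z + (2 * y) * (2 * y))
        sq′ = square-4* _ (subst IsSquare
          (trans (cong (λ t → t * t + (4 * y) * (4 * y)) x≡2z) (quadruple y z)) sq)
        by-parity-z : Dec (2 ∣ z) → ⊥
        by-parity-z (no 2∤z) = odd+4*odd-nonsquare 2∤z 2∤y sq′
        by-parity-z (yes 2∣z) = swapped 4 (inj₂ refl) w
          (trans x≡2z (trans (cong (2 *_) z≡2w) (sym (*-assoc 2 2 w)))) 2∤y
          (square-4* _ (subst IsSquare
            (trans (cong (λ t → t * t + (2 * y) * (2 * y)) z≡2w) (double y w)) sq′))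
          where
          w = quotient 2∣z
          z≡2w : z ≡ 2 * w
          z≡2w = m∣n⇒n≡m*quotient 2∣z

open Naturals using (IsSquare; coprime-squares; no-squares)

open import Agda.Builtin.FromNat using (Number; fromNat)
open import Agda.Builtin.FromNeg using (Negative; fromNeg)
open import Data.Empty using (⊥; ⊥-elim)
open import Data.List.Base using ([]; _∷_)
open import Data.Nat.Base as ℕ using (ℕ)
import Data.Nat.Properties as ℕ
import Data.Nat.Divisibility as ℕ
import Data.Nat.Literals
open import Data.Nat.Coprimality as Co using (Coprime)
open import Data.Integer.Base as ℤ using (ℤ; +_; -[1+_]; ∣_∣)
import Data.Integer.Properties as ℤ
open import Data.Product using (∃; ∃₂; _×_; _,_; proj₁; proj₂)
open import Data.Rational hiding (Negative; ∣_∣)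
open import Data.Rational.Literals using (fromℤ)
import Data.Rational.Literals
import Data.Rational.Unnormalised.Base as ℚᵘ
import Data.Rational.Unnormalised.Properties as ℚᵘ
open import Data.Rational.Properties
open import Data.Sum using (_⊎_; inj₁; inj₂; [_,_]′)
open import Data.Unit.Base using (⊤)
open import Relation.Binary.PropositionalEquality
open import Relation.Nullary
open import Relation.Nullary.Decidable using (True; toWitness; dec⇒maybe)
open import Tactic.RingSolver using (solve; solve-∀)
open import Tactic.RingSolver.Core.AlmostCommutativeRing
  using (AlmostCommutativeRing; fromCommutativeRing)

-- Polynomial identities over the rationals.

instance
  number-ℕ : Number ℕ
  number-ℕ = Data.Nat.Literals.number
  number-ℚ : Number ℚ
  number-ℚ = Data.Rational.Literals.number
  negative-ℚ : Negative ℚ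
  negative-ℚ = Data.Rational.Literals.negative

ring : AlmostCommutativeRing _ _
ring = fromCommutativeRing +-*-commutativeRing λ x → dec⇒maybe (0ℚ ≟ x)

*-zero-product : ∀ x y → x * y ≡ 0 → x ≡ 0 ⊎ y ≡ 0
*-zero-product x y xy≡0 with x ≟ 0
... | yes x≡0 = inj₁ x≡0
... | no x≢0 = inj₂ (begin
  y               ≡⟨ *-identityˡ y ⟨
  1 * y           ≡⟨ cong (_* y) (*-inverseˡ x) ⟨
  1/ x * x * y    ≡⟨ *-assoc (1/ x) x y ⟩
  1/ x * (x * y)  ≡⟨ cong (1/ x *_) xy≡0 ⟩
  1/ x * 0        ≡⟨ *-zeroʳ (1/ x) ⟩
  0               ∎)
  where
  open ≡-Reasoning
  instance _ = ≢-nonZero x≢0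

*-cancel-≢0 : ∀ {x y} → x ≢ 0 → x * y ≡ 0 → y ≡ 0
*-cancel-≢0 {x} {y} x≢0 xy≡0 =
  [ (λ x≡0 → contradiction x≡0 x≢0) , (λ y≡0 → y≡0) ]′ (*-zero-product x y xy≡0)

p-q≡0⇒p≡q : ∀ x y → x - y ≡ 0 → x ≡ y
p-q≡0⇒p≡q x y eq = begin
  x             ≡⟨ shift x y ⟩
  x - y + y     ≡⟨ cong (_+ y) eq ⟩
  0 + y         ≡⟨ +-identityˡ y ⟩
  y             ∎
  where
  open ≡-Reasoning
  shift : ∀ x y → x ≡ x - y + y
  shift = solve-∀ ring

vanish : ∀ c {l r} → l ≡ r → c * (l - r) ≡ 0
vanish c {l} refl = trans (cong (c *_) (+-inverseʳ l)) (*-zeroʳ c)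

-- The coefficient is a certificate: once g - h is exhibited as a combination of the differences of
-- the hypotheses, only an identity for the ring solver remains. All eliminations below have this
-- form.
linear₁ : ∀ {l r} c {g h} → l ≡ r → g - h ≡ c * (l - r) → g ≡ h
linear₁ c l≡r eq = p-q≡0⇒p≡q _ _ (trans eq (vanish c l≡r))

linear₂ : ∀ {l₁ r₁ l₂ r₂} c₁ c₂ {g h} → l₁ ≡ r₁ → l₂ ≡ r₂ →
  g - h ≡ c₁ * (l₁ - r₁) + c₂ * (l₂ - r₂) → g ≡ h
linear₂ c₁ c₂ eq₁ eq₂ eq = p-q≡0⇒p≡q _ _
  (trans eq (cong₂ _+_ (vanish c₁ eq₁) (vanish c₂ eq₂)))

linear₃ : ∀ {l₁ r₁ l₂ r₂ l₃ r₃} c₁ c₂ c₃ {g h} → l₁ ≡ r₁ → l₂ ≡ r₂ → l₃ ≡ r₃ →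
  g - h ≡ c₁ * (l₁ - r₁) + c₂ * (l₂ - r₂) + c₃ * (l₃ - r₃) → g ≡ h
linear₃ c₁ c₂ c₃ eq₁ eq₂ eq₃ eq = p-q≡0⇒p≡q _ _
  (trans eq (cong₂ _+_ (cong₂ _+_ (vanish c₁ eq₁) (vanish c₂ eq₂)) (vanish c₃ eq₃)))

-- Integers among the rationals, and rational nonsquares.

fromℤ-+ : ∀ i j → fromℤ (i ℤ.+ j) ≡ fromℤ i + fromℤ j
fromℤ-+ i j = begin
  fromℤ (i ℤ.+ j)                       ≡⟨ ↥p/↧p≡p (fromℤ (i ℤ.+ j)) ⟨
  (i ℤ.+ j) / 1                         ≡⟨ cong₂ (λ i j → (i ℤ.+ j) / 1) (ℤ.*-identityʳ i) (ℤ.*-identityʳ j) ⟨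
  (i ℤ.* + 1 ℤ.+ j ℤ.* + 1) / 1         ∎
  where open ≡-Reasoning

fromℤ-* : ∀ i j → fromℤ (i ℤ.* j) ≡ fromℤ i * fromℤ j
fromℤ-* i j = sym (↥p/↧p≡p (fromℤ (i ℤ.* j)))

fromℤ-injective : ∀ {i j} → fromℤ i ≡ fromℤ j → i ≡ j
fromℤ-injective refl = refl

*-denominator : ∀ x → x * fromℤ (↧ x) ≡ fromℤ (↥ x)
*-denominator x@record{} = toℚᵘ-injective (ℚᵘ.≃-trans (toℚᵘ-homo-* x (fromℤ (↧ x)))
  (ℚᵘ.*≡* (trans (ℤ.*-identityʳ (↥ x ℤ.* ↧ x))
    (cong (λ n → ↥ x ℤ.* + n) (sym (ℕ.*-identityʳ (↧ₙ x)))))))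

square-∣∣ : ∀ i → i ℤ.* i ≡ + (∣ i ∣ ℕ.* ∣ i ∣)
square-∣∣ (+ n) = sym (ℤ.pos-* n n)
square-∣∣ -[1+ n ] = refl

coprime-parts : ∀ x → Coprime ∣ ↥ x ∣ (↧ₙ x)
coprime-parts (mkℚ n d-1 c) = Co.recompute c

abstract
  -- For x = n / d in lowest terms, d² divides n² and is coprime to it, so d² = 1.
  integral-square : ∀ x z → x * x ≡ fromℤ z → ∃ λ m → + (m ℕ.* m) ≡ z
  integral-square x z x²≡z = ∣ n ∣ , sym (begin
    z                     ≡⟨ ℤ.*-identityʳ z ⟨
    z ℤ.* + 1             ≡⟨ cong (λ e → z ℤ.* + e) d²≡1 ⟨
    z ℤ.* + (d ℕ.* d)     ≡⟨ n²≡zd² ⟨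
    n ℤ.* n               ≡⟨ square-∣∣ n ⟩
    + (∣ n ∣ ℕ.* ∣ n ∣)   ∎)
    where
    open ≡-Reasoning
    n : ℤ
    n = ↥ x
    d : ℕ
    d = ↧ₙ x
    exchange : ∀ x d → (x * d) * (x * d) ≡ (x * x) * (d * d)
    exchange = solve-∀ ring
    n²≡zd² : n ℤ.* n ≡ z ℤ.* + (d ℕ.* d)
    n²≡zd² = fromℤ-injective (begin
      fromℤ (n ℤ.* n)                                 ≡⟨ fromℤ-* n n ⟩
      fromℤ n * fromℤ n                               ≡⟨ cong₂ _*_ (*-denominator x) (*-denominator x) ⟨
      (x * fromℤ (+ d)) * (x * fromℤ (+ d))           ≡⟨ exchange x (fromℤ (+ d)) ⟩
      (x * x) * (fromℤ (+ d) * fromℤ (+ d))           ≡⟨ cong₂ _*_ x²≡z (sym (fromℤ-* (+ d) (+ d))) ⟩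
      fromℤ z * fromℤ (+ d ℤ.* + d)                   ≡⟨ cong (λ i → fromℤ z * fromℤ i) (ℤ.pos-* d d) ⟨
      fromℤ z * fromℤ (+ (d ℕ.* d))                   ≡⟨ fromℤ-* z (+ (d ℕ.* d)) ⟨
      fromℤ (z ℤ.* + (d ℕ.* d))                       ∎)
    d²≡1 : d ℕ.* d ≡ 1
    d²≡1 = coprime-squares (coprime-parts x)
      ( ℕ.divides ∣ z ∣ (begin
          ∣ n ∣ ℕ.* ∣ n ∣            ≡⟨ cong ∣_∣ (square-∣∣ n) ⟨
          ∣ n ℤ.* n ∣                ≡⟨ cong ∣_∣ n²≡zd² ⟩
          ∣ z ℤ.* + (d ℕ.* d) ∣      ≡⟨ ℤ.abs-* z (+ (d ℕ.* d)) ⟩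
          ∣ z ∣ ℕ.* (d ℕ.* d)        ∎)
      , ℕ.∣-refl)

between-squares : ∀ m n l → m ℕ.* m ℕ.< n → n ℕ.< ℕ.suc m ℕ.* ℕ.suc m → l ℕ.* l ≢ n
between-squares m n l m²<n n<m+1² l²≡n = [ (λ l≤m → ℕ.<⇒≱ m²<l² (ℕ.*-mono-≤ l≤m l≤m))
  , (λ m<l → ℕ.<⇒≱ l²<m+1² (ℕ.*-mono-≤ m<l m<l)) ]′ (ℕ.≤-<-connex l m)
  where
  m²<l² : m ℕ.* m ℕ.< l ℕ.* l
  m²<l² = subst (m ℕ.* m ℕ.<_) (sym l²≡n) m²<n
  l²<m+1² : l ℕ.* l ℕ.< ℕ.suc m ℕ.* ℕ.suc m
  l²<m+1² = subst (ℕ._< ℕ.suc m ℕ.* ℕ.suc m) (sym l²≡n) n<m+1²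

-- Here `m` is the integer part of the square root of `n`. The two bounds are decided by evaluation,
-- so they are found implicitly for numerals.
positive-nonsquare : ∀ m n → {True (m ℕ.* m ℕ.<? n)} → {True (n ℕ.<? ℕ.suc m ℕ.* ℕ.suc m)} →
  ∀ x → x * x ≢ fromℤ (+ n)
positive-nonsquare m n {m²<n} {n<m+1²} x x²≡n =
  between-squares m n (root .proj₁) (toWitness m²<n) (toWitness n<m+1²) (ℤ.+-injective (root .proj₂))
  where
  root : ∃ λ l → + (l ℕ.* l) ≡ + n
  root = integral-square x (+ n) x²≡n

negative-nonsquare : ∀ n x → x * x ≢ fromℤ -[1+ n ]
negative-nonsquare n x x²≡ = contradiction (integral-square x -[1+ n ] x²≡ .proj₂) λ ()

-- Writing x / y in lowest terms turns a rational solution into a primitive integral one.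
no-rational-squares : ∀ {k} → k ≡ 2 ⊎ k ≡ 4 → ∀ {x y u v} →
  x * x + y * y ≡ u * u → x * x + (fromℤ (+ k) * y) * (fromℤ (+ k) * y) ≡ v * v →
  x ≡ 0 ⊎ y ≡ 0
no-rational-squares {k} k∈ {x} {y} {u} {v} eq₁ eq₂ = cases (x ≟ 0) (y ≟ 0)
  where
  cases : Dec (x ≡ 0) → Dec (y ≡ 0) → x ≡ 0 ⊎ y ≡ 0
  cases (yes x≡0) _ = inj₁ x≡0
  cases (no _) (yes y≡0) = inj₂ y≡0
  cases (no x≢0) (no y≢0) = ⊥-elim (no-squares k∈ n≢0 (λ ()) (coprime-parts ρ)
    (square d 1 u (sym (*-identityˡ (fromℤ (+ d)))) (trans (cong (λ y → x * x + y * y) (*-identityˡ y)) eq₁))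
    (square (k ℕ.* d) (fromℤ (+ k)) v
      (trans (cong fromℤ (ℤ.pos-* k d)) (fromℤ-* (+ k) (+ d))) eq₂))
    where
    ρ : ℚ
    ρ = (x ÷ y) {{≢-nonZero y≢0}}
    n d : ℕ
    n = ∣ ↥ ρ ∣
    d = ↧ₙ ρ
    i : ℚ
    i = (1/ y) {{≢-nonZero y≢0}}
    iy≡1 : i * y ≡ 1
    iy≡1 = *-inverseˡ y {{≢-nonZero y≢0}}
    ρy≡x : ρ * y ≡ x
    ρy≡x = trans (*-assoc x i y) (trans (cong (x *_) iy≡1) (*-identityʳ x))
    n≢0 : n ≢ 0
    n≢0 n≡0 = x≢0 (trans (sym ρy≡x) (trans
      (cong (_* y) (↥p≡0⇒p≡0 ρ (ℤ.∣i∣≡0⇒i≡0 n≡0))) (*-zeroˡ y)))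
    sum-of-squares : ∀ e → fromℤ (+ (n ℕ.* n ℕ.+ e ℕ.* e)) ≡
      (ρ * fromℤ (+ d)) * (ρ * fromℤ (+ d)) + fromℤ (+ e) * fromℤ (+ e)
    sum-of-squares e = trans (fromℤ-+ (+ (n ℕ.* n)) (+ (e ℕ.* e))) (cong₂ _+_
      (trans (cong fromℤ (sym (square-∣∣ (↥ ρ)))) (trans (fromℤ-* (↥ ρ) (↥ ρ))
        (sym (cong₂ _*_ (*-denominator ρ) (*-denominator ρ)))))
      (trans (cong fromℤ (ℤ.pos-* e e)) (fromℤ-* (+ e) (+ e))))
    scale : ∀ x y i c d w → x * x + (c * y) * (c * y) ≡ w * w → i * y ≡ 1 →
      (w * i * d) * (w * i * d) ≡ (x * i * d) * (x * i * d) + (c * d) * (c * d)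
    scale x y i c d w eq iy≡1 = linear₂ (- (i * i * (d * d))) (c * c * (d * d) * (i * y + 1)) eq iy≡1
      (solve (x ∷ y ∷ i ∷ c ∷ d ∷ w ∷ []) ring)
    square : ∀ e c w → fromℤ (+ e) ≡ c * fromℤ (+ d) → x * x + (c * y) * (c * y) ≡ w * w →
      IsSquare (n ℕ.* n ℕ.+ e ℕ.* e)
    square e c w e≡cd eq = root .proj₁ , ℤ.+-injective (root .proj₂)
      where
      root : ∃ λ l → + (l ℕ.* l) ≡ + (n ℕ.* n ℕ.+ e ℕ.* e)
      root = integral-square (w * i * fromℤ (+ d)) (+ (n ℕ.* n ℕ.+ e ℕ.* e))
        (trans (scale x y i c (fromℤ (+ d)) w eq iy≡1) (sym (trans (sum-of-squares e)
          (cong (λ t → (ρ * fromℤ (+ d)) * (ρ * fromℤ (+ d)) + t * t) e≡cd))))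

-- Rational points on the quartics.

RationalPoints : ℚ → ℚ → Set
RationalPoints C E = ∀ z y → y * y ≡ (z * z - C) * (z * z - E) → z ≡ 0 ⊎ z * z ≡ C ⊎ z * z ≡ E

rational-points : ∀ {C E z y} → y ≡ 0 ⊎ 2 * z ≡ 0 → y * y ≡ (z * z - C) * (z * z - E) →
  z ≡ 0 ⊎ z * z ≡ C ⊎ z * z ≡ E
rational-points {C} {E} {z} {y} (inj₁ y≡0) eq =
  [ (λ h → inj₂ (inj₁ (p-q≡0⇒p≡q _ _ h))) , (λ h → inj₂ (inj₂ (p-q≡0⇒p≡q _ _ h))) ]′
    (*-zero-product (z * z - C) (z * z - E) (trans (sym eq) (trans (cong (_* y) y≡0) (*-zeroˡ y))))
rational-points (inj₂ 2z≡0) eq = inj₁ (*-cancel-≢0 {2} (λ ()) 2z≡0)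

-- If y² = (z² - C)(z² - E) and m² = CE, then y² + (C + E ∓ 2m) z² = (z² ∓ m)²,
-- where C + E ∓ 2m are squares.
rational-points-1-9 : RationalPoints 1 9
rational-points-1-9 z y eq = rational-points (no-rational-squares (inj₁ refl)
  {x = y} {y = 2 * z} {u = z * z - 3} {v = z * z + 3}
  (linear₁ 1 eq (solve (z ∷ y ∷ []) ring)) (linear₁ 1 eq (solve (z ∷ y ∷ []) ring))) eq

rational-points-9-25 : RationalPoints 9 25
rational-points-9-25 z y eq = rational-points (no-rational-squares (inj₂ refl)
  {x = y} {y = 2 * z} {u = z * z - 15} {v = z * z + 15}
  (linear₁ 1 eq (solve (z ∷ y ∷ []) ring)) (linear₁ 1 eq (solve (z ∷ y ∷ []) ring))) eq

-- Quadratic points on a quartic with known rational points.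

-- T and N are the trace and norm of the abscissa of a quadratic point P on
-- y² = (z² - C)(z² - E); the cases are the classes of P + P̄ up to sign.
data Fibre (C E m T N : ℚ) : Set where
  trace-zero : T ≡ 0 → Fibre C E m T N
  norm-plus  : N ≡ m → Fibre C E m T N
  norm-minus : N ≡ - m → Fibre C E m T N
  node-C     : (C + N) * (C + N) - C * (T * T) ≡ C * (C - E) → Fibre C E m T N
  node-E     : (E + N) * (E + N) - E * (T * T) ≡ E * (E - C) → Fibre C E m T N

square≡square : ∀ x y → x * x ≡ y * y → x ≡ y ⊎ x ≡ - y
square≡square x y eq =
  [ (λ h → inj₁ (p-q≡0⇒p≡q x y h)) , (λ h → inj₂ (p-q≡0⇒p≡q x (- y) (trans (double-negation x y) h))) ]′
  (*-zero-product (x - y) (x + y) (linear₁ 1 eq (solve (x ∷ y ∷ []) ring)))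
  where
  double-negation : ∀ x y → x - - y ≡ x + y
  double-negation = solve-∀ ring

*-self-zero : ∀ x → x * x ≡ 0 → x ≡ 0
*-self-zero x eq = [ (λ h → h) , (λ h → h) ]′ (*-zero-product x x eq)

-- Put m(z) = z² - Tz + N; the left side of the conclusion is m(r) m(-r). Inserting β = N + rT into
-- the last hypothesis gives m(-r) = -αr, and the sum of the roots gives α m(r) = -r(C - E).
-- Multiplying eliminates α.
node : ∀ {C} E T N α β r → r * r ≡ C →
  2 * α * (T + r) + (C + E + α * α + 2 * β) ≡ 0 → β ≡ N + r * T →
  C * E - β * β ≡ 2 * α * r * N → r * r + α * r + β ≡ 0 →
  (C + N) * (C + N) - C * (T * T) ≡ C * (C - E)
node E T N α β r refl sum refl product vertex = linear₃ (½ * (r * r)) ½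
  (r * r - r * T + N + ½ * (r * r + α * r + (N + r * T)) - (r * r + α * r) - r * r)
  sum product vertex (solve (E ∷ T ∷ N ∷ α ∷ r ∷ []) ring)

-- The residual cubic (z² - C)(z² - E) - (z² + αz + β)² vanishes modulo z² - Tz + N.
-- If α = 0 it is at most quadratic; otherwise it is -2α (z - r)(z² - Tz + N), and
-- the parabola y = z² + αz + β meets the quartic at the rational point with z = r.
fibre-of-parabola : ∀ {C E m} → RationalPoints C E → m * m ≡ C * E → C ≢ E → ∀ T N α β →
  - 2 * α * (T * T - N) - (C + E + α * α + 2 * β) * T - 2 * α * β ≡ 0 →
  2 * α * T * N + (C + E + α * α + 2 * β) * N + C * E - β * β ≡ 0 →
  Fibre C E m T N
fibre-of-parabola {C} {E} {m} points m² C≢E T N α β eq₁ eq₀ = cases (α ≟ 0)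
  where
  α≡0-case : α ≡ 0 → Fibre C E m T N
  α≡0-case refl = [ degenerate , trace-zero ]′ (*-zero-product (C + E + 2 * β) T
    (linear₁ (- 1) eq₁ (solve (C ∷ E ∷ T ∷ N ∷ β ∷ []) ring)))
    where
    -- The residual polynomial would be zero: CE = β² and C + E = -2β, hence (C - E)² = 0.
    degenerate : C + E + 2 * β ≡ 0 → Fibre C E m T N
    degenerate h = contradiction (p-q≡0⇒p≡q C E (*-self-zero (C - E)
      (linear₂ (C + E - 2 * β + 4 * N) (- 4) h eq₀ (solve (C ∷ E ∷ T ∷ N ∷ β ∷ []) ring)))) C≢E
  α≢0-case : α ≢ 0 → Fibre C E m T N
  α≢0-case α≢0 = cases-r (points r (r * r + α * r + β)
    (on-quartic r sum β≡ product))
    where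
    on-quartic : ∀ r → 2 * α * (T + r) + (C + E + α * α + 2 * β) ≡ 0 → β ≡ N + r * T →
      C * E - β * β ≡ 2 * α * r * N →
      (r * r + α * r + β) * (r * r + α * r + β) ≡ (r * r - C) * (r * r - E)
    on-quartic r sum β≡ product = linear₃ (r * r) (2 * α * r) (- 1) sum β≡ product
      (solve (C ∷ E ∷ T ∷ N ∷ α ∷ β ∷ r ∷ []) ring)
    i : ℚ
    i = (1/ α) {{≢-nonZero α≢0}}
    iα≡1 : i * α ≡ 1
    iα≡1 = *-inverseˡ α {{≢-nonZero α≢0}}
    -- The third root of the cubic, read off from the sum of its roots; `β≡` and `product` are the
    -- other two Vieta relations.
    r : ℚ
    r = - ½ * i * (C + E + α * α + 2 * β) - T
    sum-of : ∀ r S i α T → r ≡ - ½ * i * S - T → i * α ≡ 1 → 2 * α * (T + r) + S ≡ 0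
    sum-of r S i α T refl iα≡1 = linear₁ (- S) iα≡1 (solve (S ∷ i ∷ α ∷ T ∷ []) ring)
    sum : 2 * α * (T + r) + (C + E + α * α + 2 * β) ≡ 0
    sum = sum-of r (C + E + α * α + 2 * β) i α T refl iα≡1
    β-of : ∀ r → 2 * α * (T + r) + (C + E + α * α + 2 * β) ≡ 0 → α * (β - (N + r * T)) ≡ 0
    β-of r sum = linear₂ (- ½ * T) (- ½) sum eq₁ (solve (C ∷ E ∷ T ∷ N ∷ α ∷ β ∷ r ∷ []) ring)
    β≡ : β ≡ N + r * T
    β≡ = p-q≡0⇒p≡q β (N + r * T) (*-cancel-≢0 α≢0 (β-of r sum))
    product-of : ∀ r → 2 * α * (T + r) + (C + E + α * α + 2 * β) ≡ 0 → C * E - β * β ≡ 2 * α * r * N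
    product-of r sum = linear₂ 1 (- N) eq₀ sum (solve (C ∷ E ∷ T ∷ N ∷ α ∷ β ∷ r ∷ []) ring)
    product : C * E - β * β ≡ 2 * α * r * N
    product = product-of r sum
    norm² : ∀ r → r ≡ 0 → β ≡ N + r * T → C * E - β * β ≡ 2 * α * r * N → N * N ≡ m * m
    norm² r refl β≡ product = linear₃ (- 1) (- 1) (- (β + N)) m² product β≡
      (solve (C ∷ E ∷ m ∷ T ∷ N ∷ α ∷ β ∷ []) ring)
    vertex : (r * r - C) * (r * r - E) ≡ 0 → r * r + α * r + β ≡ 0
    vertex h = *-self-zero (r * r + α * r + β) (trans (on-quartic r sum β≡ product) h)
    sum-swap : ∀ r →
      2 * α * (T + r) + (C + E + α * α + 2 * β) ≡ 2 * α * (T + r) + (E + C + α * α + 2 * β)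
    sum-swap r = solve (C ∷ E ∷ T ∷ α ∷ β ∷ r ∷ []) ring
    cases-r : r ≡ 0 ⊎ r * r ≡ C ⊎ r * r ≡ E → Fibre C E m T N
    cases-r (inj₁ r≡0) = [ norm-plus , norm-minus ]′ (square≡square N m (norm² r r≡0 β≡ product))
    cases-r (inj₂ (inj₁ r²≡C)) = node-C (node E T N α β r r²≡C sum β≡ product
      (vertex (trans (cong (λ t → (t - C) * (r * r - E)) r²≡C)
        (trans (cong (_* (r * r - E)) (+-inverseʳ C)) (*-zeroˡ (r * r - E))))))
    cases-r (inj₂ (inj₂ r²≡E)) = node-E (node C T N α β r r²≡E (trans (sym (sum-swap r)) sum) β≡
      (trans (cong (_- β * β) (*-comm E C)) product)
      (vertex (trans (cong (λ t → (r * r - C) * (t - E)) r²≡E)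
        (trans (cong ((r * r - C) *_) (+-inverseʳ E)) (*-zeroʳ (r * r - C))))))
  cases : Dec (α ≡ 0) → Fibre C E m T N
  cases (yes α≡0) = α≡0-case α≡0
  cases (no α≢0) = α≢0-case α≢0

-- z = z₀ + z₁√D has trace T and norm N, and y = y₀ + γz₁√D equals z² + αz + β
-- for α = γ - T and a rational β.
fibre-of-slope : ∀ {C E m} → RationalPoints C E → m * m ≡ C * E → C ≢ E → ∀ D z₀ z₁ y₀ γ → z₁ ≢ 0 →
  let t = z₀ * z₀ + D * (z₁ * z₁) ; s = z₀ * z₁ + z₁ * z₀ in
  y₀ * y₀ + D * ((γ * z₁) * (γ * z₁)) ≡ (t - C) * (t - E) + D * (s * s) →
  y₀ * (γ * z₁) + (γ * z₁) * y₀ ≡ (t - C) * s + s * (t - E) →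
  Fibre C E m (2 * z₀) (z₀ * z₀ - D * (z₁ * z₁))
fibre-of-slope {C} {E} {m} points m² C≢E D z₀ z₁ y₀ γ z₁≢0 eq₀ eq₁ =
  fibre-of-parabola points m² C≢E T N α β residue₁ (linear₂ (- 1) (- z₀) eq₀ residue₁ (residue₀ C E D z₀ z₁ y₀ γ))
  where
  T N α β : ℚ
  T = 2 * z₀
  N = z₀ * z₀ - D * (z₁ * z₁)
  α = γ - T
  β = y₀ - γ * z₀ + N
  residue₁ : - 2 * α * (T * T - N) - (C + E + α * α + 2 * β) * T - 2 * α * β ≡ 0
  residue₁ = *-cancel-≢0 z₁≢0
    (linear₁ (- 1) eq₁ (residue₁-identity C E D z₀ z₁ y₀ γ))
    where
    residue₁-identity : ∀ C E D z₀ z₁ y₀ γ →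
      let t = z₀ * z₀ + D * (z₁ * z₁) ; s = z₀ * z₁ + z₁ * z₀
          T = 2 * z₀ ; N = z₀ * z₀ - D * (z₁ * z₁) ; α = γ - T ; β = y₀ - γ * z₀ + N in
      z₁ * (- 2 * α * (T * T - N) - (C + E + α * α + 2 * β) * T - 2 * α * β) - 0 ≡
      - 1 * (y₀ * (γ * z₁) + (γ * z₁) * y₀ - ((t - C) * s + s * (t - E)))
    residue₁-identity = solve-∀ ring
  residue₀ : ∀ C E D z₀ z₁ y₀ γ →
    let t = z₀ * z₀ + D * (z₁ * z₁) ; s = z₀ * z₁ + z₁ * z₀
        T = 2 * z₀ ; N = z₀ * z₀ - D * (z₁ * z₁) ; α = γ - T ; β = y₀ - γ * z₀ + N in
    2 * α * T * N + (C + E + α * α + 2 * β) * N + C * E - β * β - 0 ≡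
    - 1 * (y₀ * y₀ + D * ((γ * z₁) * (γ * z₁)) - ((t - C) * (t - E) + D * (s * s))) +
    - z₀ * (- 2 * α * (T * T - N) - (C + E + α * α + 2 * β) * T - 2 * α * β - 0)
  residue₀ = solve-∀ ring

fibre : ∀ {C E m} → RationalPoints C E → m * m ≡ C * E → C ≢ E → ∀ D z₀ z₁ y₀ y₁ → z₁ ≢ 0 →
  let t = z₀ * z₀ + D * (z₁ * z₁) ; s = z₀ * z₁ + z₁ * z₀ in
  y₀ * y₀ + D * (y₁ * y₁) ≡ (t - C) * (t - E) + D * (s * s) →
  y₀ * y₁ + y₁ * y₀ ≡ (t - C) * s + s * (t - E) →
  Fibre C E m (2 * z₀) (z₀ * z₀ - D * (z₁ * z₁))
fibre points m² C≢E D z₀ z₁ y₀ y₁ z₁≢0 eq₀ eq₁ =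
  fibre-of-slope points m² C≢E D z₀ z₁ y₀ γ z₁≢0
    (trans (cong (λ y → y₀ * y₀ + D * (y * y)) γz₁≡y₁) eq₀)
    (trans (cong (λ y → y₀ * y + y * y₀) γz₁≡y₁) eq₁)
  where
  γ : ℚ
  γ = y₁ * (1/ z₁) {{≢-nonZero z₁≢0}}
  γz₁≡y₁ : γ * z₁ ≡ y₁
  γz₁≡y₁ = trans (*-assoc y₁ _ z₁)
    (trans (cong (y₁ *_) (*-inverseˡ z₁ {{≢-nonZero z₁≢0}})) (*-identityʳ y₁))

-- Combining the three curves in the (T , N)-plane.

-- In terms of x with trace T and norm N, the three curves have z = x, 2x - 1 and 2x + 1.
Fibre₁ Fibre₂ Fibre₃ : ℚ → ℚ → Set
Fibre₁ T N = Fibre 1 9 3 T N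
Fibre₂ T N = Fibre 9 25 15 (2 * T - 2) (4 * N - 2 * T + 1)
Fibre₃ T N = Fibre 9 25 15 (2 * T + 2) (4 * N + 2 * T + 1)

-- The factors are the norms of x + 1 and x - 3. At `- T` these formulas give the norm and trace of
-- v² = (x - 1)(x + 3), since x ↦ -x exchanges u² and v².
norm-u² : ℚ → ℚ → ℚ
norm-u² T N = (1 + T + N) * (9 - 3 * T + N)

trace-u² : ℚ → ℚ → ℚ
trace-u² T N = T * T - 2 * N - 2 * T - 6

-- n and t are the norm and trace of u, where u² = (x + 1)(x - 3).
NormTrace : ℚ → ℚ → Set
NormTrace T N = ∃₂ λ n t → n * n ≡ norm-u² T N × t * t ≡ trace-u² T N + 2 * n

Irrational : ℚ → ℚ → Set
Irrational T N = ∀ x → x * x ≢ T * T - 4 * N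

norm-at : ∀ T N n {T₀ N₀} → n * n ≡ norm-u² T N → T ≡ T₀ → N ≡ N₀ → n * n ≡ norm-u² T₀ N₀
norm-at _ _ _ n² refl refl = n²

line-trace : ∀ N → Irrational 0 N → NormTrace 0 N → ¬ Fibre₂ 0 N
line-trace N irr _ (trace-zero ())
-- Here N = 7/2 and the norm of u² is 225/4, a square, so the trace of u is needed: its square would
-- be 2 or -28.
line-trace N irr (n , t , n² , t²) (norm-plus h) = [ plus , minus ]′ (square≡square (2 * n) 15
  (trans (scale n) (cong (4 *_) (norm-at 0 N n n² refl N≡))))
  where
  N≡ : N ≡ ½ * 7
  N≡ = linear₁ (½ * ½) h (solve (N ∷ []) ring)
  scale : ∀ n → (2 * n) * (2 * n) ≡ 4 * (n * n)
  scale = solve-∀ ring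
  t²-at : ∀ {m} → 2 * n ≡ m → t * t ≡ trace-u² 0 (½ * 7) + m
  t²-at h = trans t² (cong₂ (λ N m → trace-u² 0 N + m) N≡ h)
  plus : 2 * n ≡ 15 → ⊥
  plus h = positive-nonsquare 1 2 t (t²-at h)
  minus : 2 * n ≡ - 15 → ⊥
  minus h = negative-nonsquare 27 t (t²-at h)
line-trace N irr _ (norm-minus h) = irr 4 (cong (λ N → 0 * 0 - 4 * N) (sym N≡))
  where
  N≡ : N ≡ - 4
  N≡ = linear₁ (½ * ½) h (solve (N ∷ []) ring)
line-trace N irr _ (node-C h) = negative-nonsquare 107 (10 + 4 * N) (linear₁ 1 h (solve (N ∷ []) ring))
line-trace N irr _ (node-E h) =
  positive-nonsquare 22 500 (26 + 4 * N) (linear₁ 1 h (solve (N ∷ []) ring))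

line-norm-plus : ∀ T → NormTrace T 3 → ¬ Fibre₂ T 3
line-norm-plus T (n , _ , n² , _) (trace-zero h) = positive-nonsquare 6 45 n (norm-at T 3 n n² T≡ refl)
  where
  T≡ : T ≡ 1
  T≡ = linear₁ ½ h (solve (T ∷ []) ring)
line-norm-plus T (n , _ , n² , _) (norm-plus h) = positive-nonsquare 6 45 n (norm-at T 3 n n² T≡ refl)
  where
  T≡ : T ≡ - 1
  T≡ = linear₁ (- ½) h (solve (T ∷ []) ring)
line-norm-plus T (n , _ , n² , _) (norm-minus h) = negative-nonsquare 539 n (norm-at T 3 n n² T≡ refl)
  where
  T≡ : T ≡ 14
  T≡ = linear₁ (- ½) h (solve (T ∷ []) ring)
line-norm-plus T _ (node-C h) =
  positive-nonsquare 17 297 (4 * T + 1) (linear₁ (- ½) h (solve (T ∷ []) ring))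
line-norm-plus T _ (node-E h) =
  positive-nonsquare 37 1425 (12 * T - 3) (linear₁ (- (3 * ½)) h (solve (T ∷ []) ring))

-- At N = -3 the norm of u² is -3(T - 2)², hence the negative values below. For T = 2 the two values
-- of x are the rationals 3 and -1.
line-norm-minus : ∀ T → Irrational T (- 3) → NormTrace T (- 3) → ¬ Fibre₂ T (- 3)
line-norm-minus T irr (n , _ , n² , _) (trace-zero h) =
  negative-nonsquare 2 n (norm-at T (- 3) n n² T≡ refl)
  where
  T≡ : T ≡ 1
  T≡ = linear₁ ½ h (solve (T ∷ []) ring)
line-norm-minus T irr (n , _ , n² , _) (norm-plus h) =
  negative-nonsquare 674 n (norm-at T (- 3) n n² T≡ refl)
  where
  T≡ : T ≡ - 13
  T≡ = linear₁ (- ½) h (solve (T ∷ []) ring)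
line-norm-minus T irr _ (norm-minus h) = irr 4 (cong (λ T → T * T - 4 * - 3) (sym T≡))
  where
  T≡ : T ≡ 2
  T≡ = linear₁ (- ½) h (solve (T ∷ []) ring)
line-norm-minus T irr (n , _ , n² , _) (node-C h) =
  [ (λ h → large (p-q≡0⇒p≡q (2 * T) 7 h)) , (λ h → small (p-q≡0⇒p≡q T (- 1) h)) ]′
    (*-zero-product (2 * T - 7) (T - - 1) (linear₁ (- (½ * ½ * ½ * ½)) h (solve (T ∷ []) ring)))
  where
  scale : ∀ n → (2 * n) * (2 * n) ≡ 4 * (n * n)
  scale = solve-∀ ring
  large : 2 * T ≡ 7 → ⊥
  large h = negative-nonsquare 26 (2 * n) (trans (scale n) (cong (4 *_) (norm-at T (- 3) n n² T≡ refl)))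
    where
    T≡ : T ≡ ½ * 7
    T≡ = linear₁ ½ h (solve (T ∷ []) ring)
  small : T ≡ - 1 → ⊥
  small h = negative-nonsquare 26 n (norm-at T (- 3) n n² h refl)
line-norm-minus T irr _ (node-E h) =
  negative-nonsquare 374 (12 * T - 9) (linear₁ (- (3 * ½)) h (solve (T ∷ []) ring))

-- With m(i) = i² - Ti + N these say m(1) m(-1) = -8, m(3) m(-3) = 72,
-- m(2) m(-1) = -9 and m(3) m(-2) = 25.
Node₁ Node₉ Node₂₋₁ Node₃₋₂ : ℚ → ℚ → Set
Node₁ T N = (1 + N) * (1 + N) - 1 * (T * T) ≡ 1 * (1 - 9)
Node₉ T N = (9 + N) * (9 + N) - 9 * (T * T) ≡ 9 * (9 - 1)

Node₂₋₁ T N = (9 + (4 * N - 2 * T + 1)) * (9 + (4 * N - 2 * T + 1)) -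
  9 * ((2 * T - 2) * (2 * T - 2)) ≡ 9 * (9 - 25)
Node₃₋₂ T N = (25 + (4 * N - 2 * T + 1)) * (25 + (4 * N - 2 * T + 1)) -
  25 * ((2 * T - 2) * (2 * T - 2)) ≡ 25 * (25 - 9)

N≡-plus : ∀ T N → 4 * N - 2 * T + 1 ≡ 15 → N ≡ ½ * (T + 7)
N≡-plus T N h = linear₁ (½ * ½) h (solve (T ∷ N ∷ []) ring)

N≡-minus : ∀ T N → 4 * N - 2 * T + 1 ≡ - 15 → N ≡ ½ * (T - 8)
N≡-minus T N h = linear₁ (½ * ½) h (solve (T ∷ N ∷ []) ring)

T≡-trace : ∀ T → 2 * T - 2 ≡ 0 → T ≡ 1
T≡-trace T h = linear₁ ½ h (solve (T ∷ []) ring)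

-- Four of the five classes of 2x - 1 are incompatible with this conic: substitution and completing
-- the square produce a rational square root of a nonsquare. The remaining conic m(3) m(-2) = 25
-- shares no factor m(i) with m(1) m(-1) = -8 and is left to the third curve.
node₁ : ∀ T N → Node₁ T N → Fibre₂ T N → Node₃₋₂ T N
node₁ T N e (trace-zero h) = ⊥-elim (trace T (T≡-trace T h) e)
  where
  trace : ∀ T → T ≡ 1 → ¬ Node₁ T N
  trace _ refl e = negative-nonsquare 6 (1 + N) (linear₁ 1 e (solve (N ∷ []) ring))
node₁ T N e (norm-plus h) = ⊥-elim (plus N (N≡-plus T N h) e)
  where
  plus : ∀ N → N ≡ ½ * (T + 7) → ¬ Node₁ T N
  plus _ refl e = positive-nonsquare 40 1680 (6 * T - 18) (linear₁ (- 48) e (solve (T ∷ []) ring))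
node₁ T N e (norm-minus h) = ⊥-elim (minus N (N≡-minus T N h) e)
  where
  minus : ∀ N → N ≡ ½ * (T - 8) → ¬ Node₁ T N
  minus _ refl e = positive-nonsquare 30 960 (6 * T + 12) (linear₁ (- 48) e (solve (T ∷ []) ring))
-- Both products contain m(-1), so m(-1) (9 m(1) - 8 m(2)) = 0; the second factor is N + 7T - 23.
node₁ T N e (node-C h) = ⊥-elim ([ m₋₁≡0 , proportional ]′ (*-zero-product (1 + T + N) (N + 7 * T - 23)
  (linear₂ 9 (- ½) e h (solve (T ∷ N ∷ []) ring))))
  where
  m₋₁≡0 : 1 + T + N ≡ 0 → ⊥
  m₋₁≡0 h = contradiction 0≡8 λ ()
    where
    0≡8 : 0 ≡ 8
    0≡8 = linear₂ (- 1) (1 + N - T) e h (solve (T ∷ N ∷ []) ring)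
  quadratic : ∀ N → N ≡ 23 - 7 * T → ¬ Node₁ T N
  quadratic _ refl e = positive-nonsquare 3 12 (12 * T - 42) (linear₁ 3 e (solve (T ∷ []) ring))
  proportional : N + 7 * T - 23 ≡ 0 → ⊥
  proportional h = quadratic N (linear₁ 1 h (solve (T ∷ N ∷ []) ring)) e
node₁ T N e (node-E h) = h

-- As for `node₁`, with m(2) m(-1) = -9 now the conic that shares no factor with m(3) m(-3) = 72.
node₉ : ∀ T N → Irrational T N → NormTrace T N → Node₉ T N → Fibre₂ T N → Node₂₋₁ T N
node₉ T N irr (n , _ , n² , _) e (trace-zero h) =
  -- At T = 1 the conic has two rational points: N = 0 makes x rational, and N = -18 gives u² the
  -- norm 192.
  ⊥-elim ([ N≡0 , N≡-18 ]′ (square≡square (9 + N) 9 (trace T T≡1 e)))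
  where
  T≡1 : T ≡ 1
  T≡1 = T≡-trace T h
  trace : ∀ T → T ≡ 1 → Node₉ T N → (9 + N) * (9 + N) ≡ 9 * 9
  trace _ refl e = linear₁ 1 e (solve (N ∷ []) ring)
  N≡0 : 9 + N ≡ 9 → ⊥
  N≡0 h = irr 1 (sym (cong₂ (λ T N → T * T - 4 * N) T≡1 N≡))
    where
    N≡ : N ≡ 0
    N≡ = linear₁ 1 h (solve (N ∷ []) ring)
  N≡-18 : 9 + N ≡ - 9 → ⊥
  N≡-18 h = positive-nonsquare 13 192 n (norm-at T N n n² T≡1 N≡)
    where
    N≡ : N ≡ - 18
    N≡ = linear₁ 1 h (solve (N ∷ []) ring)
node₉ T N _ _ e (norm-plus h) = ⊥-elim (plus N (N≡-plus T N h) e)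
  where
  plus : ∀ N → N ≡ ½ * (T + 7) → ¬ Node₉ T N
  plus _ refl e = positive-nonsquare 222 49680 (70 * T - 50) (linear₁ (- 560) e (solve (T ∷ []) ring))
node₉ T N _ _ e (norm-minus h) = ⊥-elim (minus N (N≡-minus T N h) e)
  where
  minus : ∀ N → N ≡ ½ * (T - 8) → ¬ Node₉ T N
  minus _ refl e = negative-nonsquare 25919 (70 * T - 20) (linear₁ (- 560) e (solve (T ∷ []) ring))
node₉ T N _ _ e (node-C h) = h
-- The common factor is m(3), and the cofactor 25 m(-3) - 72 m(-2) equals -63 - 69T - 47N.
node₉ T N _ _ e (node-E h) = ⊥-elim ([ m₃≡0 , proportional ]′
  (*-zero-product (9 - 3 * T + N) (- 63 - 69 * T - 47 * N)
    (linear₂ 25 (- (9 * ½)) e h (solve (T ∷ N ∷ []) ring))))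
  where
  m₃≡0 : 9 - 3 * T + N ≡ 0 → ⊥
  m₃≡0 h = contradiction 0≡72 λ ()
    where
    0≡72 : 0 ≡ 72
    0≡72 = linear₂ 1 (- (9 + 3 * T + N)) e h (solve (T ∷ N ∷ []) ring)
  proportional : - 63 - 69 * T - 47 * N ≡ 0 → ⊥
  proportional h = positive-nonsquare 1092 1192860 (1260 * T + 2070)
    (linear₂ (- 231945) (- 105 * (783 - 69 * T + 47 * N)) e h (solve (T ∷ N ∷ []) ring))

fibre-flip : ∀ {C E m T N T′ N′} → T′ ≡ - T → N′ ≡ N → Fibre C E m T N → Fibre C E m T′ N′
fibre-flip refl refl (trace-zero refl) = trace-zero refl
fibre-flip refl refl (norm-plus h) = norm-plus h
fibre-flip refl refl (norm-minus h) = norm-minus h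
fibre-flip {C} {E} {m} {T} {N} refl refl (node-C h) = node-C (trans (even C N T) h)
  where
  even : ∀ C N T → (C + N) * (C + N) - C * (- T * - T) ≡ (C + N) * (C + N) - C * (T * T)
  even = solve-∀ ring
fibre-flip {C} {E} {m} {T} {N} refl refl (node-E h) = node-E (trans (even E N T) h)
  where
  even : ∀ C N T → (C + N) * (C + N) - C * (- T * - T) ≡ (C + N) * (C + N) - C * (T * T)
  even = solve-∀ ring

-- Under x ↦ -x the abscissa 2x + 1 becomes -(2x - 1), and a fibre is insensitive to the sign of z.
-- The analysis of the second curve thus covers the third.
fibre₃⇒fibre₂ : ∀ T N → Fibre₃ T N → Fibre₂ (- T) N
fibre₃⇒fibre₂ T N = fibre-flip (flip-trace T) (flip-norm T N)
  where
  flip-trace : ∀ T → 2 * - T - 2 ≡ - (2 * T + 2)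
  flip-trace = solve-∀ ring
  flip-norm : ∀ T N → 4 * N - 2 * - T + 1 ≡ 4 * N + 2 * T + 1
  flip-norm = solve-∀ ring

-- The difference of the equations at T and -T is a multiple of T (6 - N).
nodes₁ : ∀ T N → Node₁ T N → Node₃₋₂ T N → ¬ Node₃₋₂ (- T) N
nodes₁ T N e h₂ h₃ = [ T≡0 , N≡6 ]′ (*-zero-product T (6 - N)
  (linear₂ (½ * ½ * ½ * ½ * ½) (- (½ * ½ * ½ * ½ * ½)) h₂ h₃ (solve (T ∷ N ∷ []) ring)))
  where
  T≡0 : T ≡ 0 → ⊥
  T≡0 h = negative-nonsquare 7 (1 + N) (linear₂ 1 T e h (solve (T ∷ N ∷ []) ring))
  N≡6 : 6 - N ≡ 0 → ⊥
  N≡6 h = positive-nonsquare 7 57 T (linear₂ (- 1) (- (N + 8)) e h (solve (T ∷ N ∷ []) ring))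

-- Here the difference of the equations at T and -T is a multiple of T (2 - N). At N = 2 the two
-- conics would give T² = 49/9 and T² = 27/2.
nodes₉ : ∀ T N → Node₉ T N → Node₂₋₁ T N → ¬ Node₂₋₁ (- T) N
nodes₉ T N e h₂ h₃ = [ T≡0 , N≡2 ]′ (*-zero-product T (2 - N)
  (linear₂ (½ * ½ * ½ * ½ * ½) (- (½ * ½ * ½ * ½ * ½)) h₂ h₃ (solve (T ∷ N ∷ []) ring)))
  where
  T≡0 : T ≡ 0 → ⊥
  T≡0 h = positive-nonsquare 8 72 (9 + N) (linear₂ 1 (9 * T) e h (solve (T ∷ N ∷ []) ring))
  incompatible : ∀ N → N ≡ 2 → Node₉ T N → ¬ Node₂₋₁ T N
  incompatible _ refl e h = contradiction 0≡2320 λ ()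
    where
    0≡2320 : 0 ≡ 2320
    0≡2320 = linear₂ 32 (- 9) e h (solve (T ∷ []) ring)
  N≡2 : 2 - N ≡ 0 → ⊥
  N≡2 h = incompatible N (linear₁ (- 1) h (solve (N ∷ []) ring)) e h₂

no-fibres : ∀ T N → Irrational T N → NormTrace T N → NormTrace (- T) N →
  Fibre₁ T N → Fibre₂ T N → ¬ Fibre₃ T N
no-fibres T N irr u² v² (trace-zero refl) f₂ _ = line-trace N irr u² f₂
no-fibres T N irr u² v² (norm-plus refl) f₂ _ = line-norm-plus T u² f₂
no-fibres T N irr u² v² (norm-minus refl) f₂ _ = line-norm-minus T irr u² f₂
no-fibres T N irr u² v² (node-C e) f₂ f₃ = nodes₁ T N e (node₁ T N e f₂)
  (node₁ (- T) N (trans (even T N) e) (fibre₃⇒fibre₂ T N f₃))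
  where
  even : ∀ T N → (1 + N) * (1 + N) - 1 * (- T * - T) ≡ (1 + N) * (1 + N) - 1 * (T * T)
  even = solve-∀ ring
no-fibres T N irr u² v² (node-E e) f₂ f₃ = nodes₉ T N e (node₉ T N irr u² e f₂)
  (node₉ (- T) N (λ x x² → irr x (trans x² (square T N))) v² (trans (even T N) e) (fibre₃⇒fibre₂ T N f₃))
  where
  even : ∀ T N → (9 + N) * (9 + N) - 9 * (- T * - T) ≡ (9 + N) * (9 + N) - 9 * (T * T)
  even = solve-∀ ring
  square : ∀ T N → - T * - T - 4 * N ≡ T * T - 4 * N
  square = solve-∀ ring

-- Arithmetic in ℚ(√D) for a nonsquare D.

NonSquare : ℚ → Set
NonSquare D = ∀ x → x * x ≢ D

nonsquare-multiple : ∀ {D} → NonSquare D → ∀ x y → x * x ≡ D * (y * y) → y ≡ 0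
nonsquare-multiple {D} D≢ x y eq = cases (y ≟ 0)
  where
  quotient² : ∀ i → i * y ≡ 1 → (x * i) * (x * i) ≡ D
  quotient² i iy≡1 = linear₂ (i * i) (D * (i * y + 1)) eq iy≡1 (solve (D ∷ x ∷ y ∷ i ∷ []) ring)
  cases : Dec (y ≡ 0) → y ≡ 0
  cases (yes y≡0) = y≡0
  cases (no y≢0) = ⊥-elim (D≢ (x * i) (quotient² i (*-inverseˡ y {{≢-nonZero y≢0}})))
    where
    i : ℚ
    i = (1/ y) {{≢-nonZero y≢0}}

-- Multiplying zw = 0 by the conjugate of z gives norm(z) w = 0, and for nonsquare D the norm
-- vanishes only at z = 0.
√-zero-product : ∀ {D} → NonSquare D → ∀ z₀ z₁ w₀ w₁ →
  z₀ * w₀ + D * (z₁ * w₁) ≡ 0 → z₀ * w₁ + z₁ * w₀ ≡ 0 →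
  (z₀ ≡ 0 × z₁ ≡ 0) ⊎ (w₀ ≡ 0 × w₁ ≡ 0)
√-zero-product {D} D≢ z₀ z₁ w₀ w₁ eq₀ eq₁ = cases (z₀ * z₀ - D * (z₁ * z₁) ≟ 0)
  where
  w₀-multiple : (z₀ * z₀ - D * (z₁ * z₁)) * w₀ ≡ 0
  w₀-multiple = linear₂ z₀ (- (D * z₁)) eq₀ eq₁ (solve (D ∷ z₀ ∷ z₁ ∷ w₀ ∷ w₁ ∷ []) ring)
  w₁-multiple : (z₀ * z₀ - D * (z₁ * z₁)) * w₁ ≡ 0
  w₁-multiple = linear₂ (- z₁) z₀ eq₀ eq₁ (solve (D ∷ z₀ ∷ z₁ ∷ w₀ ∷ w₁ ∷ []) ring)
  cases : Dec (z₀ * z₀ - D * (z₁ * z₁) ≡ 0) → (z₀ ≡ 0 × z₁ ≡ 0) ⊎ (w₀ ≡ 0 × w₁ ≡ 0)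
  cases (no norm≢0) = inj₂ (*-cancel-≢0 norm≢0 w₀-multiple , *-cancel-≢0 norm≢0 w₁-multiple)
  cases (yes norm≡0) = inj₁ (*-self-zero z₀ (trans z₀²≡ (vanishing z₁≡0)) , z₁≡0)
    where
    z₀²≡ : z₀ * z₀ ≡ D * (z₁ * z₁)
    z₀²≡ = p-q≡0⇒p≡q _ _ norm≡0
    z₁≡0 : z₁ ≡ 0
    z₁≡0 = nonsquare-multiple D≢ z₀ z₁ z₀²≡
    vanishing : ∀ {z} → z ≡ 0 → D * (z * z) ≡ 0
    vanishing refl = *-zeroʳ D

-- (u₀ + u₁√D)² = e₀ + e₁√D.
record SquareRoot (D u₀ u₁ e₀ e₁ : ℚ) : Set where
  constructor mk
  field
    rational   : u₀ * u₀ + D * (u₁ * u₁) ≡ e₀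
    irrational : u₀ * u₁ + u₁ * u₀ ≡ e₁

square-root-* : ∀ {D u₀ u₁ e₀ e₁ v₀ v₁ f₀ f₁} → SquareRoot D u₀ u₁ e₀ e₁ → SquareRoot D v₀ v₁ f₀ f₁ →
  SquareRoot D (u₀ * v₀ + D * (u₁ * v₁)) (u₀ * v₁ + u₁ * v₀) (e₀ * f₀ + D * (e₁ * f₁)) (e₀ * f₁ + e₁ * f₀)
square-root-* {D} {u₀} {u₁} {v₀ = v₀} {v₁} (mk refl refl) (mk refl refl) =
  mk (lemma₀ D u₀ u₁ v₀ v₁) (lemma₁ D u₀ u₁ v₀ v₁)
  where
  lemma₀ : ∀ D u₀ u₁ v₀ v₁ →
    (u₀ * v₀ + D * (u₁ * v₁)) * (u₀ * v₀ + D * (u₁ * v₁)) + D * ((u₀ * v₁ + u₁ * v₀) * (u₀ * v₁ + u₁ * v₀)) ≡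
    (u₀ * u₀ + D * (u₁ * u₁)) * (v₀ * v₀ + D * (v₁ * v₁)) + D * ((u₀ * u₁ + u₁ * u₀) * (v₀ * v₁ + v₁ * v₀))
  lemma₀ = solve-∀ ring
  lemma₁ : ∀ D u₀ u₁ v₀ v₁ →
    (u₀ * v₀ + D * (u₁ * v₁)) * (u₀ * v₁ + u₁ * v₀) + (u₀ * v₁ + u₁ * v₀) * (u₀ * v₀ + D * (u₁ * v₁)) ≡
    (u₀ * u₀ + D * (u₁ * u₁)) * (v₀ * v₁ + v₁ * v₀) + (u₀ * u₁ + u₁ * u₀) * (v₀ * v₀ + D * (v₁ * v₁))
  lemma₁ = solve-∀ ring

-- Square classes and the case of rational x.

data SquareClass (D e : ℚ) : Set where
  trivial    : ∀ r → r * r ≡ e → SquareClass D e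
  nontrivial : ∀ r → D * (r * r) ≡ e → SquareClass D e

-- The √D-part 2u₀u₁ vanishes, so one of the two coordinates of the root is zero.
square-class : ∀ {D u₀ u₁ e₀ e₁} → e₁ ≡ 0 → SquareRoot D u₀ u₁ e₀ e₁ → SquareClass D e₀
square-class {D} {u₀} {u₁} refl (mk refl eq) =
  [ (λ { refl → nontrivial u₁ (drop₀ D u₁) }) , (λ { refl → trivial u₀ (drop₁ D u₀) }) ]′
  (*-zero-product u₀ u₁ (linear₁ ½ eq (solve (u₀ ∷ u₁ ∷ []) ring)))
  where
  drop₀ : ∀ D u → D * (u * u) ≡ 0 * 0 + D * (u * u)
  drop₀ = solve-∀ ring
  drop₁ : ∀ D u → u * u ≡ u * u + D * (0 * 0)
  drop₁ = solve-∀ ring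

-- Three numbers fall into two square classes, so two of them have a square product, which is a
-- rational point on one of the curves. Points with y = 0 make a factor vanish, so only z = 0
-- remains: x = 0 on the first curve and x = 1/2 or -1/2 on the others.
rational-case : ∀ {D} x → x ≢ 0 → let e = (x + 1) * (x - 3) ; f = (x - 1) * (x + 3) ; g = (x - 2) * (x + 2) in
  e ≢ 0 → f ≢ 0 → g ≢ 0 → SquareClass D e → SquareClass D f → ¬ SquareClass D g
rational-case {D} x x≢0 e≢0 f≢0 g≢0 = λ where
    (trivial r r²) (trivial s s²) _ → ef-square (trivial-product r s r² s²)
    (nontrivial r r²) (nontrivial s s²) _ → ef-square (nontrivial-product r s r² s²)
    (trivial r r²) (nontrivial s s²) (trivial t t²) → eg-square (trivial-product r t r² t²) (inj₁ (r , r²))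
    (trivial r r²) (nontrivial s s²) (nontrivial t t²) → fg-square (nontrivial-product s t s² t²) (inj₁ (r , r²))
    (nontrivial r r²) (trivial s s²) (trivial t t²) → fg-square (trivial-product s t s² t²) (inj₂ (s , s²))
    (nontrivial r r²) (trivial s s²) (nontrivial t t²) → eg-square (nontrivial-product r t r² t²) (inj₂ (s , s²))
  where
  e f g : ℚ
  e = (x + 1) * (x - 3)
  f = (x - 1) * (x + 3)
  g = (x - 2) * (x + 2)
  trivial-product : ∀ r s {e f} → r * r ≡ e → s * s ≡ f → ∃ λ y → y * y ≡ e * f
  trivial-product r s refl refl = r * s , lemma r s
    where
    lemma : ∀ r s → (r * s) * (r * s) ≡ (r * r) * (s * s)
    lemma = solve-∀ ring
  nontrivial-product : ∀ r s {e f} → D * (r * r) ≡ e → D * (s * s) ≡ f → ∃ λ y → y * y ≡ e * f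
  nontrivial-product r s refl refl = D * (r * s) , lemma D r s
    where
    lemma : ∀ D r s → (D * (r * s)) * (D * (r * s)) ≡ (D * (r * r)) * (D * (s * s))
    lemma = solve-∀ ring
  nonzero : ∀ {e f} → e ≢ 0 → f ≢ 0 → e * f ≢ 0
  nonzero e≢0 f≢0 ef≡0 = f≢0 (*-cancel-≢0 e≢0 ef≡0)
  ef-square : ¬ ∃ λ y → y * y ≡ e * f
  ef-square (y , y²) =
    [ x≢0 , [ (λ h → nonzero e≢0 f≢0 (at-1 x h)) , (λ h → nonzero e≢0 f≢0 (at-9 x h)) ]′ ]′
    (rational-points-1-9 x y (trans y² (product x)))
    where
    product : ∀ x → ((x + 1) * (x - 3)) * ((x - 1) * (x + 3)) ≡ (x * x - 1) * (x * x - 9)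
    product = solve-∀ ring
    at-1 : ∀ x → x * x ≡ 1 → ((x + 1) * (x - 3)) * ((x - 1) * (x + 3)) ≡ 0
    at-1 x h = linear₁ (x * x - 9) h (solve (x ∷ []) ring)
    at-9 : ∀ x → x * x ≡ 9 → ((x + 1) * (x - 3)) * ((x - 1) * (x + 3)) ≡ 0
    at-9 x h = linear₁ (x * x - 1) h (solve (x ∷ []) ring)
  scale : ∀ y → (4 * y) * (4 * y) ≡ 16 * (y * y)
  scale = solve-∀ ring
  double : ∀ r → (2 * r) * (2 * r) ≡ 4 * (r * r)
  double = solve-∀ ring
  negative-values : ∀ m n → 4 * e ≡ fromℤ -[1+ m ] → 4 * f ≡ fromℤ -[1+ n ] →
    ¬ ((∃ λ r → r * r ≡ e) ⊎ (∃ λ s → s * s ≡ f))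
  negative-values m n e≡ f≡ (inj₁ (r , r²)) =
    negative-nonsquare m (2 * r) (trans (double r) (trans (cong (4 *_) r²) e≡))
  negative-values m n e≡ f≡ (inj₂ (r , r²)) =
    negative-nonsquare n (2 * r) (trans (double r) (trans (cong (4 *_) r²) f≡))
  eg-square : (∃ λ y → y * y ≡ e * g) → ¬ ((∃ λ r → r * r ≡ e) ⊎ (∃ λ s → s * s ≡ f))
  eg-square (y , y²) squares = [ at-0
    , [ (λ h → nonzero e≢0 g≢0 (at-9 x h)) , (λ h → nonzero e≢0 g≢0 (at-25 x h)) ]′ ]′
    (rational-points-9-25 (2 * x - 1) (4 * y) (trans (scale y) (trans (cong (16 *_) y²) (product x))))
    where
    product : ∀ x → 16 * (((x + 1) * (x - 3)) * ((x - 2) * (x + 2))) ≡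
      ((2 * x - 1) * (2 * x - 1) - 9) * ((2 * x - 1) * (2 * x - 1) - 25)
    product = solve-∀ ring
    at-9 : ∀ x → (2 * x - 1) * (2 * x - 1) ≡ 9 → ((x + 1) * (x - 3)) * ((x - 2) * (x + 2)) ≡ 0
    at-9 x h = linear₁ (½ * ½ * ((x - 3) * (x + 2))) h (solve (x ∷ []) ring)
    at-25 : ∀ x → (2 * x - 1) * (2 * x - 1) ≡ 25 → ((x + 1) * (x - 3)) * ((x - 2) * (x + 2)) ≡ 0
    at-25 x h = linear₁ (½ * ½ * ((x + 1) * (x - 2))) h (solve (x ∷ []) ring)
    -- The curve really has a rational point here. At x = 1/2, however, e = -15/4 and f = -7/4 are
    -- both negative, whereas one of them is known to be a rational square.
    at-0 : 2 * x - 1 ≡ 0 → ⊥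
    at-0 h =
      negative-values 14 6 (cong (λ x → 4 * ((x + 1) * (x - 3))) x≡) (cong (λ x → 4 * ((x - 1) * (x + 3))) x≡) squares
      where
      x≡ : x ≡ ½
      x≡ = linear₁ ½ h (solve (x ∷ []) ring)
  fg-square : (∃ λ y → y * y ≡ f * g) → ¬ ((∃ λ r → r * r ≡ e) ⊎ (∃ λ s → s * s ≡ f))
  fg-square (y , y²) squares = [ at-0
    , [ (λ h → nonzero f≢0 g≢0 (at-9 x h)) , (λ h → nonzero f≢0 g≢0 (at-25 x h)) ]′ ]′
    (rational-points-9-25 (2 * x + 1) (4 * y) (trans (scale y) (trans (cong (16 *_) y²) (product x))))
    where
    product : ∀ x → 16 * (((x - 1) * (x + 3)) * ((x - 2) * (x + 2))) ≡
      ((2 * x + 1) * (2 * x + 1) - 9) * ((2 * x + 1) * (2 * x + 1) - 25)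
    product = solve-∀ ring
    at-9 : ∀ x → (2 * x + 1) * (2 * x + 1) ≡ 9 → ((x - 1) * (x + 3)) * ((x - 2) * (x + 2)) ≡ 0
    at-9 x h = linear₁ (½ * ½ * ((x + 3) * (x - 2))) h (solve (x ∷ []) ring)
    at-25 : ∀ x → (2 * x + 1) * (2 * x + 1) ≡ 25 → ((x - 1) * (x + 3)) * ((x - 2) * (x + 2)) ≡ 0
    at-25 x h = linear₁ (½ * ½ * ((x - 1) * (x + 2))) h (solve (x ∷ []) ring)
    at-0 : 2 * x + 1 ≡ 0 → ⊥
    at-0 h =
      negative-values 6 14 (cong (λ x → 4 * ((x + 1) * (x - 3))) x≡) (cong (λ x → 4 * ((x - 1) * (x + 3))) x≡) squares
      where
      x≡ : x ≡ - ½
      x≡ = linear₁ ½ h (solve (x ∷ []) ring)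

-- From square roots in ℚ(√D) to points on the three curves.

NonZero√ : ℚ → ℚ → Set
NonZero√ z₀ z₁ = ¬ (z₀ ≡ 0 × z₁ ≡ 0)

square-root-nonzero : ∀ {D u₀ u₁ e₀ e₁} → NonSquare D → NonZero√ u₀ u₁ → e₁ ≡ 0 →
  SquareRoot D u₀ u₁ e₀ e₁ → e₀ ≢ 0
square-root-nonzero {u₀ = u₀} {u₁} D≢ u≢0 e₁≡0 (mk eq₀ eq₁) e₀≡0 =
  [ u≢0 , u≢0 ]′ (√-zero-product D≢ u₀ u₁ u₀ u₁ (trans eq₀ e₀≡0) (trans eq₁ e₁≡0))

square-root-cong : ∀ {D u₀ u₁ e₀ e₁ f₀ f₁} → e₀ ≡ f₀ → e₁ ≡ f₁ → SquareRoot D u₀ u₁ e₀ e₁ →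
  SquareRoot D u₀ u₁ f₀ f₁
square-root-cong refl refl u² = u²

square-root-4* : ∀ {D u₀ u₁ e₀ e₁} → SquareRoot D u₀ u₁ e₀ e₁ →
  SquareRoot D (4 * u₀) (4 * u₁) (16 * e₀) (16 * e₁)
square-root-4* {D} {u₀} {u₁} (mk refl refl) = mk (lemma₀ D u₀ u₁) (lemma₁ u₀ u₁)
  where
  lemma₀ : ∀ D u₀ u₁ → (4 * u₀) * (4 * u₀) + D * ((4 * u₁) * (4 * u₁)) ≡ 16 * (u₀ * u₀ + D * (u₁ * u₁))
  lemma₀ = solve-∀ ring
  lemma₁ : ∀ u₀ u₁ → (4 * u₀) * (4 * u₁) + (4 * u₁) * (4 * u₀) ≡ 16 * (u₀ * u₁ + u₁ * u₀)
  lemma₁ = solve-∀ ring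

square-root-norm : ∀ {D u₀ u₁ e₀ e₁} → SquareRoot D u₀ u₁ e₀ e₁ →
  ∃₂ λ n t → n * n ≡ e₀ * e₀ - D * (e₁ * e₁) × t * t ≡ 2 * e₀ + 2 * n
square-root-norm {D} {u₀} {u₁} (mk refl refl) =
  u₀ * u₀ - D * (u₁ * u₁) , 2 * u₀ , norm D u₀ u₁ , trace D u₀ u₁
  where
  norm : ∀ D u₀ u₁ → (u₀ * u₀ - D * (u₁ * u₁)) * (u₀ * u₀ - D * (u₁ * u₁)) ≡
    (u₀ * u₀ + D * (u₁ * u₁)) * (u₀ * u₀ + D * (u₁ * u₁)) - D * ((u₀ * u₁ + u₁ * u₀) * (u₀ * u₁ + u₁ * u₀))
  norm = solve-∀ ring
  trace : ∀ D u₀ u₁ → (2 * u₀) * (2 * u₀) ≡ 2 * (u₀ * u₀ + D * (u₁ * u₁)) + 2 * (u₀ * u₀ - D * (u₁ * u₁))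
  trace = solve-∀ ring

fibre-of-root : ∀ {C E m D y₀ y₁ e₀ e₁} → RationalPoints C E → m * m ≡ C * E → C ≢ E →
  ∀ z₀ z₁ → z₁ ≢ 0 → SquareRoot D y₀ y₁ e₀ e₁ →
  let t = z₀ * z₀ + D * (z₁ * z₁) ; s = z₀ * z₁ + z₁ * z₀ in
  e₀ ≡ (t - C) * (t - E) + D * (s * s) → e₁ ≡ (t - C) * s + s * (t - E) →
  Fibre C E m (2 * z₀) (z₀ * z₀ - D * (z₁ * z₁))
fibre-of-root {D = D} {y₀} {y₁} points m² C≢E z₀ z₁ z₁≢0 (mk eq₀ eq₁) e₀≡ e₁≡ =
  fibre points m² C≢E D z₀ z₁ y₀ y₁ z₁≢0 (trans eq₀ e₀≡) (trans eq₁ e₁≡)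

-- (u₀ + u₁√D)² = (x + i)(x + j) for x = x₀ + x₁√D.
ProductSquareRoot : ℚ → ℚ → ℚ → ℚ → ℚ → ℚ → ℚ → Set
ProductSquareRoot D u₀ u₁ x₀ x₁ i j =
  SquareRoot D u₀ u₁ ((x₀ + i) * (x₀ + j) + D * (x₁ * x₁)) ((x₀ + i) * x₁ + x₁ * (x₀ + j))

module _ {D} (D≢ : NonSquare D) {x₀ x₁ u₀ u₁ v₀ v₁ w₀ w₁}
  (u² : ProductSquareRoot D u₀ u₁ x₀ x₁ 1 (- 3))
  (v² : ProductSquareRoot D v₀ v₁ x₀ x₁ (- 1) 3)
  (w² : ProductSquareRoot D w₀ w₁ x₀ x₁ (- 2) 2) where

  no-rational-x : x₁ ≡ 0 → NonZero√ x₀ x₁ → NonZero√ u₀ u₁ → NonZero√ v₀ v₁ → ¬ NonZero√ w₀ w₁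
  no-rational-x x₁≡0 x≢0 u≢0 v≢0 w≢0 = rational-case x₀ (λ x₀≡0 → x≢0 (x₀≡0 , x₁≡0))
    (square-root-nonzero D≢ u≢0 refl u²′) (square-root-nonzero D≢ v≢0 refl v²′)
    (square-root-nonzero D≢ w≢0 refl w²′)
    (square-class refl u²′) (square-class refl v²′) (square-class refl w²′)
    where
    value₀ : ∀ {x₁} i j → x₁ ≡ 0 → (x₀ + i) * (x₀ + j) + D * (x₁ * x₁) ≡ (x₀ + i) * (x₀ + j)
    value₀ i j refl = solve (D ∷ x₀ ∷ i ∷ j ∷ []) ring
    value₁ : ∀ {x₁} i j → x₁ ≡ 0 → (x₀ + i) * x₁ + x₁ * (x₀ + j) ≡ 0
    value₁ i j refl = solve (x₀ ∷ i ∷ j ∷ []) ring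
    u²′ : SquareRoot D u₀ u₁ ((x₀ + 1) * (x₀ - 3)) 0
    u²′ = square-root-cong (value₀ 1 (- 3) x₁≡0) (value₁ 1 (- 3) x₁≡0) u²
    v²′ : SquareRoot D v₀ v₁ ((x₀ - 1) * (x₀ + 3)) 0
    v²′ = square-root-cong (value₀ (- 1) 3 x₁≡0) (value₁ (- 1) 3 x₁≡0) v²
    w²′ : SquareRoot D w₀ w₁ ((x₀ - 2) * (x₀ + 2)) 0
    w²′ = square-root-cong (value₀ (- 2) 2 x₁≡0) (value₁ (- 2) 2 x₁≡0) w²

  no-irrational-x : x₁ ≢ 0 → ⊥
  no-irrational-x x₁≢0 = no-fibres T N irr
    (norm-trace T N u² (norm-u D x₀ x₁) (trace-u D x₀ x₁))
    (norm-trace (- T) N v² (norm-v D x₀ x₁) (trace-v D x₀ x₁)) f₁ f₂ f₃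
    where
    T N : ℚ
    T = 2 * x₀
    N = x₀ * x₀ - D * (x₁ * x₁)
    irr : Irrational T N
    irr x x² =
      2≢0 (*-cancel-≢0 x₁≢0 (trans (*-comm x₁ 2) (nonsquare-multiple D≢ x (2 * x₁) (trans x² (discriminant D x₀ x₁)))))
      where
      2≢0 : 2 ≢ 0
      2≢0 ()
      discriminant : ∀ D x₀ x₁ →
        (2 * x₀) * (2 * x₀) - 4 * (x₀ * x₀ - D * (x₁ * x₁)) ≡ D * ((2 * x₁) * (2 * x₁))
      discriminant = solve-∀ ring
    norm-trace : ∀ T N {u₀ u₁ e₀ e₁} → SquareRoot D u₀ u₁ e₀ e₁ →
      e₀ * e₀ - D * (e₁ * e₁) ≡ norm-u² T N → 2 * e₀ ≡ trace-u² T N → NormTrace T N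
    norm-trace T N u² norm trace = let (n , t , n² , t²) = square-root-norm u² in
      n , t , trans n² norm , trans t² (cong (_+ 2 * n) trace)
    norm-u : ∀ D x₀ x₁ → let T = 2 * x₀ ; N = x₀ * x₀ - D * (x₁ * x₁)
                             e₀ = (x₀ + 1) * (x₀ - 3) + D * (x₁ * x₁) ; e₁ = (x₀ + 1) * x₁ + x₁ * (x₀ - 3) in
      e₀ * e₀ - D * (e₁ * e₁) ≡ (1 + T + N) * (9 - 3 * T + N)
    norm-u = solve-∀ ring
    trace-u : ∀ D x₀ x₁ → let T = 2 * x₀ ; N = x₀ * x₀ - D * (x₁ * x₁) in
      2 * ((x₀ + 1) * (x₀ - 3) + D * (x₁ * x₁)) ≡ T * T - 2 * N - 2 * T - 6
    trace-u = solve-∀ ring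
    norm-v : ∀ D x₀ x₁ → let T = - (2 * x₀) ; N = x₀ * x₀ - D * (x₁ * x₁)
                             e₀ = (x₀ - 1) * (x₀ + 3) + D * (x₁ * x₁) ; e₁ = (x₀ - 1) * x₁ + x₁ * (x₀ + 3) in
      e₀ * e₀ - D * (e₁ * e₁) ≡ (1 + T + N) * (9 - 3 * T + N)
    norm-v = solve-∀ ring
    trace-v : ∀ D x₀ x₁ → let T = - (2 * x₀) ; N = x₀ * x₀ - D * (x₁ * x₁) in
      2 * ((x₀ - 1) * (x₀ + 3) + D * (x₁ * x₁)) ≡ T * T - 2 * N - 2 * T - 6
    trace-v = solve-∀ ring
    2x₁≢0 : 2 * x₁ ≢ 0
    2x₁≢0 h = x₁≢0 (*-cancel-≢0 {2} (λ ()) h)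
    f₁ : Fibre₁ T N
    f₁ = fibre-of-root rational-points-1-9 refl (λ ()) x₀ x₁ x₁≢0
      (square-root-* u² v²) (identity₀ D x₀ x₁) (identity₁ D x₀ x₁)
      where
      identity₀ : ∀ D x₀ x₁ → let t = x₀ * x₀ + D * (x₁ * x₁) ; s = x₀ * x₁ + x₁ * x₀
                                  e₀ = (x₀ + 1) * (x₀ - 3) + D * (x₁ * x₁) ; e₁ = (x₀ + 1) * x₁ + x₁ * (x₀ - 3)
                                  f₀ = (x₀ - 1) * (x₀ + 3) + D * (x₁ * x₁) ; f₁ = (x₀ - 1) * x₁ + x₁ * (x₀ + 3) in
        e₀ * f₀ + D * (e₁ * f₁) ≡ (t - 1) * (t - 9) + D * (s * s)
      identity₀ = solve-∀ ring
      identity₁ : ∀ D x₀ x₁ → let t = x₀ * x₀ + D * (x₁ * x₁) ; s = x₀ * x₁ + x₁ * x₀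
                                  e₀ = (x₀ + 1) * (x₀ - 3) + D * (x₁ * x₁) ; e₁ = (x₀ + 1) * x₁ + x₁ * (x₀ - 3)
                                  f₀ = (x₀ - 1) * (x₀ + 3) + D * (x₁ * x₁) ; f₁ = (x₀ - 1) * x₁ + x₁ * (x₀ + 3) in
        e₀ * f₁ + e₁ * f₀ ≡ (t - 1) * s + s * (t - 9)
      identity₁ = solve-∀ ring
    f₂ : Fibre₂ T N
    f₂ = subst₂ (Fibre 9 25 15) (trace x₀) (norm D x₀ x₁)
      (fibre-of-root rational-points-9-25 refl (λ ()) (2 * x₀ - 1) (2 * x₁) 2x₁≢0
        (square-root-4* (square-root-* u² w²)) (identity₀ D x₀ x₁) (identity₁ D x₀ x₁))
      where
      trace : ∀ x₀ → 2 * (2 * x₀ - 1) ≡ 2 * (2 * x₀) - 2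
      trace = solve-∀ ring
      norm : ∀ D x₀ x₁ → (2 * x₀ - 1) * (2 * x₀ - 1) - D * ((2 * x₁) * (2 * x₁)) ≡
        4 * (x₀ * x₀ - D * (x₁ * x₁)) - 2 * (2 * x₀) + 1
      norm = solve-∀ ring
      identity₀ : ∀ D x₀ x₁ → let z₀ = 2 * x₀ - 1 ; z₁ = 2 * x₁
                                  t = z₀ * z₀ + D * (z₁ * z₁) ; s = z₀ * z₁ + z₁ * z₀
                                  e₀ = (x₀ + 1) * (x₀ - 3) + D * (x₁ * x₁) ; e₁ = (x₀ + 1) * x₁ + x₁ * (x₀ - 3)
                                  f₀ = (x₀ - 2) * (x₀ + 2) + D * (x₁ * x₁) ; f₁ = (x₀ - 2) * x₁ + x₁ * (x₀ + 2) in
        16 * (e₀ * f₀ + D * (e₁ * f₁)) ≡ (t - 9) * (t - 25) + D * (s * s)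
      identity₀ = solve-∀ ring
      identity₁ : ∀ D x₀ x₁ → let z₀ = 2 * x₀ - 1 ; z₁ = 2 * x₁
                                  t = z₀ * z₀ + D * (z₁ * z₁) ; s = z₀ * z₁ + z₁ * z₀
                                  e₀ = (x₀ + 1) * (x₀ - 3) + D * (x₁ * x₁) ; e₁ = (x₀ + 1) * x₁ + x₁ * (x₀ - 3)
                                  f₀ = (x₀ - 2) * (x₀ + 2) + D * (x₁ * x₁) ; f₁ = (x₀ - 2) * x₁ + x₁ * (x₀ + 2) in
        16 * (e₀ * f₁ + e₁ * f₀) ≡ (t - 9) * s + s * (t - 25)
      identity₁ = solve-∀ ring
    f₃ : Fibre₃ T N
    f₃ = subst₂ (Fibre 9 25 15) (trace x₀) (norm D x₀ x₁)
      (fibre-of-root rational-points-9-25 refl (λ ()) (2 * x₀ + 1) (2 * x₁) 2x₁≢0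
        (square-root-4* (square-root-* v² w²)) (identity₀ D x₀ x₁) (identity₁ D x₀ x₁))
      where
      trace : ∀ x₀ → 2 * (2 * x₀ + 1) ≡ 2 * (2 * x₀) + 2
      trace = solve-∀ ring
      norm : ∀ D x₀ x₁ → (2 * x₀ + 1) * (2 * x₀ + 1) - D * ((2 * x₁) * (2 * x₁)) ≡
        4 * (x₀ * x₀ - D * (x₁ * x₁)) + 2 * (2 * x₀) + 1
      norm = solve-∀ ring
      identity₀ : ∀ D x₀ x₁ → let z₀ = 2 * x₀ + 1 ; z₁ = 2 * x₁
                                  t = z₀ * z₀ + D * (z₁ * z₁) ; s = z₀ * z₁ + z₁ * z₀
                                  e₀ = (x₀ - 1) * (x₀ + 3) + D * (x₁ * x₁) ; e₁ = (x₀ - 1) * x₁ + x₁ * (x₀ + 3)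
                                  f₀ = (x₀ - 2) * (x₀ + 2) + D * (x₁ * x₁) ; f₁ = (x₀ - 2) * x₁ + x₁ * (x₀ + 2) in
        16 * (e₀ * f₀ + D * (e₁ * f₁)) ≡ (t - 9) * (t - 25) + D * (s * s)
      identity₀ = solve-∀ ring
      identity₁ : ∀ D x₀ x₁ → let z₀ = 2 * x₀ + 1 ; z₁ = 2 * x₁
                                  t = z₀ * z₀ + D * (z₁ * z₁) ; s = z₀ * z₁ + z₁ * z₀
                                  e₀ = (x₀ - 1) * (x₀ + 3) + D * (x₁ * x₁) ; e₁ = (x₀ - 1) * x₁ + x₁ * (x₀ + 3)
                                  f₀ = (x₀ - 2) * (x₀ + 2) + D * (x₁ * x₁) ; f₁ = (x₀ - 2) * x₁ + x₁ * (x₀ + 2) in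
        16 * (e₀ * f₁ + e₁ * f₀) ≡ (t - 9) * s + s * (t - 25)
      identity₁ = solve-∀ ring

  no-points : NonZero√ x₀ x₁ → NonZero√ u₀ u₁ → NonZero√ v₀ v₁ → ¬ NonZero√ w₀ w₁
  no-points = cases (x₁ ≟ 0)
    where
    cases : Dec (x₁ ≡ 0) → NonZero√ x₀ x₁ → NonZero√ u₀ u₁ → NonZero√ v₀ v₁ → ¬ NonZero√ w₀ w₁
    cases (yes x₁≡0) = no-rational-x x₁≡0
    cases (no x₁≢0) _ _ _ _ = no-irrational-x x₁≢0

-- The edges of the graph as equations.

record Edge (D c₀ c₁ z₀ z₁ w₀ w₁ : ℚ) : Set where
  constructor mk
  field
    rational   : z₀ * z₀ + D * (z₁ * z₁) + c₀ ≡ w₀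
    irrational : z₀ * z₁ + z₁ * z₀ + c₁ ≡ w₁

module _ {D} (D≢ : NonSquare D) {c₀ c₁ : ℚ} where

  -- The difference of the two edge equations is (z - w)(z + w - 1) = 0. In `common-image` and
  -- `2-cycle` the second factor is z + w and z + w + 1.
  fixed-points : ∀ {z₀ z₁ w₀ w₁} → Edge D c₀ c₁ z₀ z₁ z₀ z₁ → Edge D c₀ c₁ w₀ w₁ w₀ w₁ →
    NonZero√ (z₀ - w₀) (z₁ - w₁) → z₀ + w₀ - 1 ≡ 0 × z₁ + w₁ ≡ 0
  fixed-points {z₀} {z₁} {w₀} {w₁} (mk z-eq₀ z-eq₁) (mk w-eq₀ w-eq₁) z≢w =
    [ (λ z≡w → ⊥-elim (z≢w z≡w)) , (λ h → h) ]′ (√-zero-product D≢ (z₀ - w₀) (z₁ - w₁) (z₀ + w₀ - 1) (z₁ + w₁)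
      (linear₂ 1 (- 1) z-eq₀ w-eq₀ (solve (D ∷ c₀ ∷ z₀ ∷ z₁ ∷ w₀ ∷ w₁ ∷ []) ring))
      (linear₂ 1 (- 1) z-eq₁ w-eq₁ (solve (D ∷ c₁ ∷ z₀ ∷ z₁ ∷ w₀ ∷ w₁ ∷ []) ring)))

  common-image : ∀ {z₀ z₁ w₀ w₁ t₀ t₁} → Edge D c₀ c₁ z₀ z₁ t₀ t₁ → Edge D c₀ c₁ w₀ w₁ t₀ t₁ →
    NonZero√ (z₀ - w₀) (z₁ - w₁) → z₀ + w₀ ≡ 0 × z₁ + w₁ ≡ 0
  common-image {z₀} {z₁} {w₀} {w₁} {t₀} {t₁} (mk z-eq₀ z-eq₁) (mk w-eq₀ w-eq₁) z≢w =
    [ (λ z≡w → ⊥-elim (z≢w z≡w)) , (λ h → h) ]′ (√-zero-product D≢ (z₀ - w₀) (z₁ - w₁) (z₀ + w₀) (z₁ + w₁)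
      (linear₂ 1 (- 1) z-eq₀ w-eq₀ (solve (D ∷ c₀ ∷ z₀ ∷ z₁ ∷ w₀ ∷ w₁ ∷ t₀ ∷ []) ring))
      (linear₂ 1 (- 1) z-eq₁ w-eq₁ (solve (D ∷ c₁ ∷ z₀ ∷ z₁ ∷ w₀ ∷ w₁ ∷ t₁ ∷ []) ring)))

  2-cycle : ∀ {z₀ z₁ w₀ w₁} → Edge D c₀ c₁ z₀ z₁ w₀ w₁ → Edge D c₀ c₁ w₀ w₁ z₀ z₁ →
    NonZero√ (z₀ - w₀) (z₁ - w₁) → z₀ + w₀ + 1 ≡ 0 × z₁ + w₁ ≡ 0
  2-cycle {z₀} {z₁} {w₀} {w₁} (mk z-eq₀ z-eq₁) (mk w-eq₀ w-eq₁) z≢w =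
    [ (λ z≡w → ⊥-elim (z≢w z≡w)) , (λ h → h) ]′ (√-zero-product D≢ (z₀ - w₀) (z₁ - w₁) (z₀ + w₀ + 1) (z₁ + w₁)
      (linear₂ 1 (- 1) z-eq₀ w-eq₀ (solve (D ∷ c₀ ∷ z₀ ∷ z₁ ∷ w₀ ∷ w₁ ∷ []) ring))
      (linear₂ 1 (- 1) z-eq₁ w-eq₁ (solve (D ∷ c₁ ∷ z₀ ∷ z₁ ∷ w₀ ∷ w₁ ∷ []) ring)))

-- From c = a - a² and s² = b - c = -a - c one gets 4s² = 4a² - 8a, which is (x + 1)(x - 3) for x =
-- a - a′ = 2a - 1.
u-root : ∀ {D c₀ c₁ a₀ a₁ a₀′ a₁′ b₀ b₁ s₀ s₁} → a₀′ ≡ 1 - a₀ → a₁′ ≡ - a₁ → b₀ ≡ - a₀ → b₁ ≡ - a₁ →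
  Edge D c₀ c₁ a₀ a₁ a₀ a₁ → Edge D c₀ c₁ s₀ s₁ b₀ b₁ →
  ProductSquareRoot D (2 * s₀) (2 * s₁) (a₀ - a₀′) (a₁ - a₁′) 1 (- 3)
u-root {D} {c₀} {c₁} {a₀} {a₁} {s₀ = s₀} {s₁} refl refl refl refl (mk a-eq₀ a-eq₁) (mk s-eq₀ s-eq₁) = mk
  (linear₂ 4 (- 4) s-eq₀ a-eq₀ (solve (D ∷ c₀ ∷ a₀ ∷ a₁ ∷ s₀ ∷ s₁ ∷ []) ring))
  (linear₂ 4 (- 4) s-eq₁ a-eq₁ (solve (c₁ ∷ a₀ ∷ a₁ ∷ s₀ ∷ s₁ ∷ []) ring))

v-root : ∀ {D c₀ c₁ a₀ a₁ a₀′ a₁′ b₀ b₁ s₀ s₁} → a₀ ≡ 1 - a₀′ → a₁ ≡ - a₁′ → b₀ ≡ - a₀′ → b₁ ≡ - a₁′ →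
  Edge D c₀ c₁ a₀′ a₁′ a₀′ a₁′ → Edge D c₀ c₁ s₀ s₁ b₀ b₁ →
  ProductSquareRoot D (2 * s₀) (2 * s₁) (a₀ - a₀′) (a₁ - a₁′) (- 1) 3
v-root {D} {c₀} {c₁} {a₀′ =
  a₀} {a₁} {s₀ = s₀} {s₁} refl refl refl refl (mk a-eq₀ a-eq₁) (mk s-eq₀ s-eq₁) = mk
  (linear₂ 4 (- 4) s-eq₀ a-eq₀ (solve (D ∷ c₀ ∷ a₀ ∷ a₁ ∷ s₀ ∷ s₁ ∷ []) ring))
  (linear₂ 4 (- 4) s-eq₁ a-eq₁ (solve (c₁ ∷ a₀ ∷ a₁ ∷ s₀ ∷ s₁ ∷ []) ring))

-- x² = 1 - 4c and w² = -3 - 4c are the discriminants of z² - z + c and z² + z + c + 1, whose roots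
-- are the fixed points and the points of period two.
w-root : ∀ {D c₀ c₁ a₀ a₁ a₀′ a₁′ p₀ p₁ q₀ q₁} → a₀′ ≡ 1 - a₀ → a₁′ ≡ - a₁ → q₀ ≡ - 1 - p₀ → q₁ ≡ - p₁ →
  Edge D c₀ c₁ a₀ a₁ a₀ a₁ → Edge D c₀ c₁ p₀ p₁ q₀ q₁ →
  ProductSquareRoot D (p₀ - q₀) (p₁ - q₁) (a₀ - a₀′) (a₁ - a₁′) (- 2) 2
w-root {D} {c₀} {c₁} {a₀} {a₁} {p₀ = p₀} {p₁} refl refl refl refl (mk a-eq₀ a-eq₁) (mk p-eq₀ p-eq₁) = mk
  (linear₂ 4 (- 4) p-eq₀ a-eq₀ (solve (D ∷ c₀ ∷ a₀ ∷ a₁ ∷ p₀ ∷ p₁ ∷ []) ring))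
  (linear₂ 4 (- 4) p-eq₁ a-eq₁ (solve (c₁ ∷ a₀ ∷ a₁ ∷ p₀ ∷ p₁ ∷ []) ring))

complement : ∀ x y → x + y - 1 ≡ 0 → y ≡ 1 - x
complement x y h = linear₁ 1 h (solve (x ∷ y ∷ []) ring)

complement′ : ∀ x y → x + y - 1 ≡ 0 → x ≡ 1 - y
complement′ x y h = linear₁ 1 h (solve (x ∷ y ∷ []) ring)

conjugate : ∀ x y → x + y + 1 ≡ 0 → y ≡ - 1 - x
conjugate x y h = linear₁ 1 h (solve (x ∷ y ∷ []) ring)

opposite : ∀ x y → x + y ≡ 0 → y ≡ - x
opposite x y h = linear₁ 1 h (solve (x ∷ y ∷ []) ring)

opposite′ : ∀ x y → x + y ≡ 0 → x ≡ - y
opposite′ x y h = linear₁ 1 h (solve (x ∷ y ∷ []) ring)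

2*≡0⇒equal : ∀ x y → 2 * x ≡ 0 → x + y ≡ 0 → x - y ≡ 0
2*≡0⇒equal x y h h′ = linear₂ 1 (- 1) h h′ (solve (x ∷ y ∷ []) ring)

-- Application to the vertices of G₅.

open import Defs
open import Data.Integer using (ℤ; +_)
open import Relation.Binary.PropositionalEquality using (_≢_)
open import Relation.Nullary using (¬_)

squarefree⇒nonsquare : ∀ d → SquareFree d → d ≢ + 1 → NonSquare (dℚ d)
squarefree⇒nonsquare d squarefree d≢1 x x²≡d = d≢1 (trans (sym m²≡d) (cong (λ m → + (m ℕ.* m)) m≡1))
  where
  root : ∃ λ m → + (m ℕ.* m) ≡ d
  root = integral-square x d (trans x²≡d (↥p/↧p≡p (fromℤ d)))
  m : ℕ.ℕ
  m = root .proj₁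
  m²≡d : + (m ℕ.* m) ≡ d
  m²≡d = root .proj₂
  m≡1 : m ≡ 1
  m≡1 = squarefree m (ℕ.∣-reflexive (cong ∣_∣ m²≡d))

theorem5p13 : (d : ℤ) → SquareFree d → d ≢ + 1 →
    (c : QF d) → ¬ ContainsG5 d c
theorem5p13 d squarefree d≢1 c G =
  no-points D≢
    (u-root (complement (re a) (re a') (aa′ .proj₁)) (opposite (im a) (im a') (aa′ .proj₂))
      (opposite (re a) (re b) (ab .proj₁)) (opposite (im a) (im b) (ab .proj₂))
      (edge a) (edge s))
    (v-root (complement′ (re a) (re a') (aa′ .proj₁)) (opposite′ (im a) (im a') (aa′ .proj₂))
      (opposite (re a') (re b') (a′b′ .proj₁)) (opposite (im a') (im b') (a′b′ .proj₂))
      (edge a') (edge r))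
    (w-root (complement (re a) (re a') (aa′ .proj₁)) (opposite (im a) (im a') (aa′ .proj₂))
      (conjugate (re p) (re q) (pq .proj₁)) (opposite (im p) (im q) (pq .proj₂))
      (edge a) (edge p))
    (distinct a a' λ ())
    -- As s¯ = -s, vanishing of u = 2s would identify `s` with `s¯`; the same holds for v and `r`.
    (λ (h₀ , h₁) → distinct s s¯ (λ ())
      ( 2*≡0⇒equal (re s) (re s¯) h₀ (ss¯ .proj₁)
      , 2*≡0⇒equal (im s) (im s¯) h₁ (ss¯ .proj₂)))
    (λ (h₀ , h₁) → distinct r r¯ (λ ())
      ( 2*≡0⇒equal (re r) (re r¯) h₀ (rr¯ .proj₁)
      , 2*≡0⇒equal (im r) (im r¯) h₁ (rr¯ .proj₂)))
    (distinct p q λ ())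
  where
  open ContainsG5 G
  D≢ : NonSquare (dℚ d)
  D≢ = squarefree⇒nonsquare d squarefree d≢1
  re im : V5 → ℚ
  re v = φ v .proj₁
  im v = φ v .proj₂
  edge : ∀ v → Edge (dℚ d) (c .proj₁) (c .proj₂) (re v) (im v) (re (next v)) (im (next v))
  edge v = mk (cong proj₁ (edges v)) (cong proj₂ (edges v))
  distinct : ∀ v w → v ≢ w → NonZero√ (re v - re w) (im v - im w)
  distinct v w v≢w (h₀ , h₁) =
    v≢w (inj (cong₂ _,_ (p-q≡0⇒p≡q (re v) (re w) h₀) (p-q≡0⇒p≡q (im v) (im w) h₁)))
  aa′ : re a + re a' - 1 ≡ 0 × im a + im a' ≡ 0
  aa′ = fixed-points D≢ (edge a) (edge a') (distinct a a' λ ())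
  ab : re a + re b ≡ 0 × im a + im b ≡ 0
  ab = common-image D≢ (edge a) (edge b) (distinct a b λ ())
  a′b′ : re a' + re b' ≡ 0 × im a' + im b' ≡ 0
  a′b′ = common-image D≢ (edge a') (edge b') (distinct a' b' λ ())
  pq : re p + re q + 1 ≡ 0 × im p + im q ≡ 0
  pq = 2-cycle D≢ (edge p) (edge q) (distinct p q λ ())
  ss¯ : re s + re s¯ ≡ 0 × im s + im s¯ ≡ 0
  ss¯ = common-image D≢ (edge s) (edge s¯) (distinct s s¯ λ ())
  rr¯ : re r + re r¯ ≡ 0 × im r + im r¯ ≡ 0
  rr¯ = common-image D≢ (edge r) (edge r¯) (distinct r r¯ λ ())
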